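{- Fix positive integers $r,k<\infty$. For any $r$-coloring $C:\mathbb{Q}_+\to\{1,\dots,r\}$ of the positive rationals, there exist $x_1,\dots,x_k\in\mathbb{Q}_+$ (not necessarily distinct) such that the set \[\left\{\sum_{j=1}^{\ell}\prod_{i\in I_j}x_i \;:\; \ell\ge 1,\ I_1,\dots,I_\ell\subset[k]\text{ non-empty and pairwise disjoint}\right\}\] is monochromatic under $C$.
   Context: $\mathbb{Q}_+$ denotes the set of positive rationals (zero excluded), and $[k]=\{1,\dots,k\}$. -}

module Defs where

open import Data.Bool using (true; false)
open import Data.Nat using (ℕ; zero; suc)
open import Data.Fin using (Fin; zero; suc)
open import Data.Fin.Subset using (Subset; _∈_; _∉_; Nonempty)
open import Data.Vec using ([]; _∷_)
open import Data.Rational using (ℚ; Positive; 0ℚ; 1ℚ; _+_; _*_)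
open import Data.Product using (Σ)
open import Function using (_∘_)
open import Relation.Binary.PropositionalEquality using (_≢_)

ℚ₊ : Set
ℚ₊ = Σ ℚ Positive

prodSub : ∀ {k} → Subset k → (Fin k → ℚ) → ℚ
prodSub [] x = 1ℚ
prodSub (true ∷ S) x = x zero * prodSub S (x ∘ suc)
prodSub (false ∷ S) x = prodSub S (x ∘ suc)

sumFin : ∀ {ℓ} → (Fin ℓ → ℚ) → ℚ
sumFin {zero} f = 0ℚ
sumFin {suc ℓ} f = f zero + sumFin (f ∘ suc)

PairwiseDisjoint : ∀ {ℓ k} → (Fin ℓ → Subset k) → Set
PairwiseDisjoint {ℓ} {k} I = (a b : Fin ℓ) → a ≢ b → (i : Fin k) → i ∈ I a → i ∉ I b

{-# OPTIONS --safe #-}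
-- Call y₁, …, y_n leading if every sum of at most k products over disjoint index sets has the colour of the summand
-- that contains the largest index.  In a leading system, Folkman's finite unions theorem applied to the colouring I ↦ C (∏_{i∈I} y_i)
-- yields disjoint blocks all of whose unions have one colour, and the block products are the required x's.
--
-- Leading systems are built one element at a time.  Given y, one looks for a and t such that
-- C (a · u(ty) + v(ty)) = C (a · u(ty)) for all monomials u and all sums v of nonconstant monomials; then ty, a is again
-- leading, provided that y stays leading under every scale t that can occur.  For this, the range of t must be known
-- before y, so all recurrence theorems are uniform in an environment X of parameters.  If u has degree i the condition
-- reads C (α (tⁱ a + p(t))) = C (α tⁱ a) with p(0) = 0.  It is solved for i < n by writing t = s τ: the degree n
-- condition is an instance of the polynomial van der Waerden theorem for s with the variable b = sⁿ a, in which the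
-- shifts for the lower degrees, which come from τ, are polynomials in s.  The polynomial theorem itself is
-- proved by colour focusing and PET induction, following Walters.
module Submission where

open import Defs
open import Data.Nat using (ℕ; suc; _≥_)
open import Data.Fin using (Fin)
open import Data.Fin.Subset using (Subset; Nonempty)
open import Data.Rational using (ℚ)
open import Data.Product using (Σ; proj₁; _,_)
open import Relation.Binary.PropositionalEquality using (_≡_)

open import Data.Nat as ℕ using (zero)
import Data.Nat.Properties as ℕ
open import Data.Bool using (Bool; true; false; if_then_else_)
open import Data.Fin as Fin using (zero; suc; funToFin; finToFun)
open import Data.Fin.Properties as Fin using (finToFun-funToFin; pigeonhole)
open import Data.Fin.Subset using (⊥)
open import Data.Maybe as Maybe using (Maybe; just; nothing)
open import Data.Vec as Vec using (Vec; []; _∷_)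
open import Data.Vec.Properties using (lookup-map; lookup⇒[]=; []=⇒lookup)
open import Data.Product using (_×_; proj₂; ∃)
open import Function using (_∘_; id)
open import Relation.Nullary using (Dec; yes; no; contradiction)
open import Relation.Binary.PropositionalEquality

-- Folkman's finite unions theorem.

module FiniteUnions where
  open import Data.Nat using (_+_; _^_)
  open import Data.Fin using (_↑ˡ_; _↑ʳ_)
  open import Data.Vec using (lookup; replicate; _++_; _[_]≔_)
  open import Data.Vec.Properties using (map-∘; map-cong; map-++; map-replicate)
  open import Data.Vec.Properties using (lookup-++ˡ; lookup-++ʳ; lookup-replicate; lookup∘update; lookup∘update′)

  -- Disjoint blocks in Fin M: position m lies in block i when its label is just i, and in no block when it is nothing.
  Blocks : ℕ → ℕ → Set
  Blocks k M = Vec (Maybe (Fin k)) M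

  select : ∀ {k} → Subset k → Maybe (Fin k) → Bool
  select I nothing = false
  select I (just i) = lookup I i

  union : ∀ {k M} → Blocks k M → Subset k → Subset M
  union φ I = Vec.map (select I) φ

  AllNonempty : ∀ {k M} → Blocks k M → Set
  AllNonempty {k} φ = ∀ i → ∃ λ m → lookup φ m ≡ just i

  union-nonempty : ∀ {k M} {φ : Blocks k M} → AllNonempty φ → ∀ {I} → Nonempty I → Nonempty (union φ I)
  union-nonempty {φ = φ} ne {I} (i , i∈) = let m , eq = ne i in
    m , lookup⇒[]= m _ (trans (lookup-map m (select I) φ) (trans (cong (select I) eq) ([]=⇒lookup i∈)))

  initial : ∀ {r} → Fin (suc r) → Subset r
  initial {zero} _ = []
  initial {suc r} zero = ⊥
  initial {suc r} (suc i) = true ∷ initial i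

  -- Encodes two initial segments as two blocks: the smaller segment joins block `zero` and the
  -- difference becomes block `suc zero`, so switching the latter on or off moves between the
  -- segments.
  interval : ∀ {N r} → Fin (suc r) → Fin (suc r) → Blocks (suc (suc N)) r
  interval {r = zero} _ _ = []
  interval {r = suc r} _ zero = replicate _ nothing
  interval {r = suc r} zero (suc j) = just (suc zero) ∷ interval zero j
  interval {r = suc r} (suc i) (suc j) = just zero ∷ interval i j

  union-interval : ∀ {N r} {i j : Fin (suc r)} → i Fin.≤ j → ∀ b (I : Subset N) →
    union (interval i j) (true ∷ b ∷ I) ≡ initial (if b then j else i)
  union-interval {r = zero} _ _ _ = refl
  union-interval {r = suc r} {zero} {zero} _ true I = map-replicate _ nothing (suc r)
  union-interval {r = suc r} {zero} {zero} _ false I = map-replicate _ nothing (suc r)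
  union-interval {r = suc r} {zero} {suc j} _ true I = cong (true ∷_) (union-interval {i = zero} {j} ℕ.z≤n true I)
  union-interval {r = suc r} {zero} {suc j} _ false I = cong (false ∷_) (trans (union-interval {i = zero} {j} ℕ.z≤n false I) (initial-zero r))
    where
    initial-zero : ∀ r → initial {r} zero ≡ ⊥
    initial-zero zero = refl
    initial-zero (suc r) = refl
  union-interval {r = suc r} {suc i} {suc j} (ℕ.s≤s i≤j) true I = cong (true ∷_) (union-interval i≤j true I)
  union-interval {r = suc r} {suc i} {suc j} (ℕ.s≤s i≤j) false I = cong (true ∷_) (union-interval i≤j false I)

  interval-nonempty : ∀ {N r} {i j : Fin (suc r)} → i Fin.< j → ∃ λ m → lookup (interval {N} i j) m ≡ just (suc zero)
  interval-nonempty {r = zero} {zero} {zero} ()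
  interval-nonempty {r = suc r} {zero} {suc j} _ = zero , refl
  interval-nonempty {r = suc r} {suc i} {suc j} (ℕ.s≤s i<j) = let m , eq = interval-nonempty i<j in suc m , eq

  -- Frees index `suc zero` for the new block; block `zero`, which every controlled union contains,
  -- stays in place.
  insertBlock : ∀ {N} → Maybe (Fin (suc N)) → Maybe (Fin (suc (suc N)))
  insertBlock nothing = nothing
  insertBlock (just zero) = just zero
  insertBlock (just (suc i)) = just (suc (suc i))

  select-insertBlock : ∀ {N} b c (I : Subset N) l → select (b ∷ c ∷ I) (insertBlock l) ≡ select (b ∷ I) l
  select-insertBlock b c I nothing = refl
  select-insertBlock b c I (just zero) = refl
  select-insertBlock b c I (just (suc i)) = refl

  union-map : ∀ {k k′ M} (f : Maybe (Fin k) → Maybe (Fin k′)) {I J} →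
    (∀ l → select I (f l) ≡ select J l) → ∀ (φ : Blocks k M) → union (Vec.map f φ) I ≡ union φ J
  union-map f eq φ = trans (sym (map-∘ _ f φ)) (map-cong eq φ)

  -- A set form of Hilbert's cube lemma: only the unions that contain block `zero` are controlled.
  Cube : ℕ → ℕ → ℕ → Set
  Cube r N M = ∀ (c : Subset M → Fin r) → Σ (Blocks (suc N) M) λ φ → AllNonempty φ ×
    Σ (Fin r) λ col → ∀ I → c (union φ (true ∷ I)) ≡ col

  -- Each set of later positions is coloured by the word of `r + 1` colours it gets when joined with
  -- the initial segments of `r` fresh positions. On a cube for these `r ^ suc r` colours,
  -- pigeonhole gives two segments of equal colour, and their difference is the new block.
  cube : ∀ N r → ∃ (Cube r N)
  cube zero r = 1 , λ c → just zero ∷ [] , (λ { zero → zero , refl }) , _ , λ { [] → refl }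
  cube (suc N) r = r + M , λ c → extend c (rec (λ S → funToFin (λ i → c (initial i ++ S))))
    where
    M : ℕ
    M = proj₁ (cube N (r ^ suc r))
    rec : Cube (r ^ suc r) N M
    rec = proj₂ (cube N (r ^ suc r))
    extend : ∀ c → (Σ (Blocks (suc N) M) λ φ → AllNonempty φ × Σ (Fin (r ^ suc r)) λ col →
        ∀ I → funToFin {suc r} (λ i → c (initial i ++ union φ (true ∷ I))) ≡ col) →
      Σ (Blocks (suc (suc N)) (r + M)) λ φ → AllNonempty φ × Σ (Fin r) λ col → ∀ I → c (union φ (true ∷ I)) ≡ col
    extend c (φ , ne , col , mono) =
      let i , j , i<j , eq = pigeonhole (ℕ.n<1+n r) (finToFun {r} {suc r} col) in new i j i<j eq
      where
      new : ∀ i j → i Fin.< j → finToFun {r} {suc r} col i ≡ finToFun col j →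
        Σ (Blocks (suc (suc N)) (r + M)) λ φ → AllNonempty φ × Σ (Fin r) λ col → ∀ I → c (union φ (true ∷ I)) ≡ col
      new i j i<j eq = ψ , ne′ , finToFun col i , mono′
        where
        ψ : Blocks (suc (suc N)) (r + M)
        ψ = interval i j ++ Vec.map insertBlock φ
        ne′ : AllNonempty ψ
        ne′ (suc zero) = let m , e = interval-nonempty i<j in
          m ↑ˡ M , trans (lookup-++ˡ (interval i j) _ m) e
        ne′ zero = let m , e = ne zero in
          r ↑ʳ m , trans (lookup-++ʳ (interval i j) _ m) (trans (lookup-map m insertBlock φ) (cong insertBlock e))
        ne′ (suc (suc a)) = let m , e = ne (suc a) in
          r ↑ʳ m , trans (lookup-++ʳ (interval i j) _ m) (trans (lookup-map m insertBlock φ) (cong insertBlock e))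
        chosen : ∀ b → finToFun {r} {suc r} col (if b then j else i) ≡ finToFun col i
        chosen true = sym eq
        chosen false = refl
        mono′ : ∀ I → c (union ψ (true ∷ I)) ≡ finToFun col i
        mono′ (b ∷ I) = begin
          c (union ψ (true ∷ b ∷ I)) ≡⟨ cong c (trans (map-++ _ (interval i j) (Vec.map insertBlock φ))
            (cong₂ _++_ (union-interval (ℕ.<⇒≤ i<j) b I) (union-map insertBlock (select-insertBlock true b I) φ))) ⟩
          c (initial (if b then j else i) ++ union φ (true ∷ I)) ≡⟨ sym (finToFun-funToFin (λ i → c (initial i ++ union φ (true ∷ I))) (if b then j else i)) ⟩
          finToFun (funToFin (λ i → c (initial i ++ union φ (true ∷ I)))) (if b then j else i)
            ≡⟨ cong (λ k → finToFun k (if b then j else i)) (mono I) ⟩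
          finToFun col (if b then j else i) ≡⟨ chosen b ⟩
          finToFun col i ∎
          where open ≡-Reasoning

  Mono : ∀ {r M} → (Subset M → Fin r) → Fin r → ℕ → Set
  Mono {M = M} c col k = Σ (Blocks k M) λ φ → AllNonempty φ × (∀ I → Nonempty I → c (union φ I) ≡ col)

  -- Blocks of blocks: `φ` groups the blocks of a cube other than block `zero`, which is dropped
  -- here and kept as a block of its own in `nestTop`.
  nest : ∀ {k N} → Blocks k N → Maybe (Fin (suc N)) → Maybe (Fin k)
  nest φ nothing = nothing
  nest φ (just zero) = nothing
  nest φ (just (suc m)) = lookup φ m

  nestTop : ∀ {k N} → Blocks k N → Maybe (Fin (suc N)) → Maybe (Fin (suc k))
  nestTop φ nothing = nothing
  nestTop φ (just zero) = just zero
  nestTop φ (just (suc m)) = Maybe.map suc (lookup φ m)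

  select-nest : ∀ {k N} (φ : Blocks k N) I l → select I (nest φ l) ≡ select (false ∷ union φ I) l
  select-nest φ I nothing = refl
  select-nest φ I (just zero) = refl
  select-nest φ I (just (suc m)) = sym (lookup-map m (select I) φ)

  select-nestTop : ∀ {k N} (φ : Blocks k N) b I l → select (b ∷ I) (nestTop φ l) ≡ select (b ∷ union φ I) l
  select-nestTop φ b I nothing = refl
  select-nestTop φ b I (just zero) = refl
  select-nestTop φ b I (just (suc m)) = trans (select-suc (lookup φ m)) (sym (lookup-map m (select I) φ))
    where
    select-suc : ∀ l → select (b ∷ I) (Maybe.map suc l) ≡ select I l
    select-suc nothing = refl
    select-suc (just i) = refl

  module _ {r M N : ℕ} (c : Subset M → Fin r) (D : Blocks (suc N) M) (D-ne : AllNonempty D) where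

    restrict : ∀ {col k} → Mono (λ S → c (union D (false ∷ S))) col k → Mono c col k
    restrict (φ , ne , mono) = Vec.map (nest φ) D ,
      (λ i → let x , e = ne i ; m , e′ = D-ne (suc x) in
        m , trans (lookup-map m (nest φ) D) (trans (cong (nest φ) e′) e)) ,
      λ I I≠∅ → trans (cong c (union-map (nest φ) (select-nest φ I) D)) (mono I I≠∅)

    adjoin : ∀ {col k} → (∀ I → c (union D (true ∷ I)) ≡ col) →
      Mono (λ S → c (union D (false ∷ S))) col k → Mono c col (suc k)
    adjoin {col} {k} top (φ , ne , mono) = Vec.map (nestTop φ) D , ne′ , mono′
      where
      ne′ : AllNonempty (Vec.map (nestTop φ) D)
      ne′ zero = let m , e = D-ne zero in m , trans (lookup-map m (nestTop φ) D) (cong (nestTop φ) e)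
      ne′ (suc i) = let x , e = ne i ; m , e′ = D-ne (suc x) in
        m , trans (lookup-map m (nestTop φ) D) (trans (cong (nestTop φ) e′) (cong (Maybe.map suc) e))
      mono′ : ∀ I → Nonempty I → c (union (Vec.map (nestTop φ) D) I) ≡ col
      mono′ (true ∷ I) _ = trans (cong c (union-map (nestTop φ) (select-nestTop φ true I) D)) (top (union φ I))
      mono′ (false ∷ I) (suc i , Vec.there i∈) =
        trans (cong c (union-map (nestTop φ) (select-nestTop φ false I) D)) (mono I (i , i∈))

  mono-zero : ∀ {r M} (c : Subset M → Fin r) {col} → Mono c col 0
  mono-zero c = replicate _ nothing , (λ ()) , λ { [] (() , _) }

  sum-decrease : ∀ {r} (k : Vec ℕ r) i {m} → lookup k i ≡ suc m → Vec.sum k ≡ suc (Vec.sum (k [ i ]≔ m))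
  sum-decrease (a ∷ k) zero refl = refl
  sum-decrease (a ∷ k) (suc i) eq = trans (cong (a +_) (sum-decrease k i eq)) (ℕ.+-suc a _)

  lookup≤sum : ∀ {r} (k : Vec ℕ r) i → lookup k i ℕ.≤ Vec.sum k
  lookup≤sum (a ∷ k) zero = ℕ.m≤m+n a _
  lookup≤sum (a ∷ k) (suc i) = ℕ.≤-trans (lookup≤sum k i) (ℕ.m≤n+m _ a)

  -- Off-diagonal form, with one target per colour as for Ramsey numbers, so that induction on the
  -- sum of the targets is possible.
  Folkman : ∀ r → ℕ → ℕ → Set
  Folkman r n M = ∀ (k : Vec ℕ r) → Vec.sum k ℕ.≤ n → ∀ (c : Subset M → Fin r) → Σ (Fin r) λ col → Mono c col (lookup k col)

  -- A cube fixes a colour `col` for the unions with its block `zero`. The target of `col` is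
  -- lowered by one and induction is applied to the other blocks; if it returns `col`, block `zero`
  -- makes up for the missing one, and any other colour returned kept its target.
  folkman-targets : ∀ {r} → Fin r → ∀ n → ∃ (Folkman r n)
  folkman-targets c₀ zero = 0 , λ k sum≤0 c →
    c₀ , subst (Mono c c₀) (sym (ℕ.n≤0⇒n≡0 (ℕ.≤-trans (lookup≤sum k c₀) sum≤0))) (mono-zero c)
  folkman-targets {r} c₀ (suc n) = M , λ k sum≤ c →
      let D , D-ne , col , top = proj₂ (cube N r) c
      in extend k sum≤ c D D-ne col top (lookup k col) refl
    where
    N M : ℕ
    N = proj₁ (folkman-targets c₀ n)
    M = proj₁ (cube N r)
    extend : ∀ k → Vec.sum k ℕ.≤ suc n → ∀ c (D : Blocks (suc N) M) → AllNonempty D → ∀ col →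
      (∀ I → c (union D (true ∷ I)) ≡ col) → ∀ m → lookup k col ≡ m →
      Σ (Fin r) λ col → Mono c col (lookup k col)
    extend k sum≤ c D D-ne col top zero eq = col , subst (Mono c col) (sym eq) (mono-zero c)
    extend k sum≤ c D D-ne col top (suc m) eq =
      let col′ , mono = proj₂ (folkman-targets c₀ n) (k [ col ]≔ m)
            (ℕ.s≤s⁻¹ (subst (ℕ._≤ suc n) (sum-decrease k col eq) sum≤)) (λ S → c (union D (false ∷ S)))
      in col′ , finish col′ mono (col′ Fin.≟ col)
      where
      finish : ∀ col′ → Mono (λ S → c (union D (false ∷ S))) col′ (lookup (k [ col ]≔ m) col′) →
        Dec (col′ ≡ col) → Mono c col′ (lookup k col′)
      finish _ mono (yes refl) = subst (Mono c col) (sym eq)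
        (adjoin c D D-ne top (subst (Mono (λ S → c (union D (false ∷ S))) col) (lookup∘update col k m) mono))
      finish col′ mono (no col≢) = restrict c D D-ne (subst (Mono (λ S → c (union D (false ∷ S))) col′) (lookup∘update′ col≢ k m) mono)

  folkman : ∀ {r} → Fin r → ∀ k → ∃ λ M → ∀ (c : Subset M → Fin r) → Σ (Fin r) λ col → Mono c col k
  folkman {r} c₀ k = let M , f = folkman-targets c₀ (Vec.sum (replicate r k)) in
    M , λ c → let col , mono = f (replicate r k) ℕ.≤-refl c in
      col , subst (Mono c col) (lookup-replicate col k) mono

open FiniteUnions

open import Algebra.Bundles using (CommutativeRing)
import Data.Bool.Properties as Bool
open import Data.Nat using (_∸_)
open import Data.Nat.Properties using (n<1+n)
open import Data.Fin.Properties using (any?; injective⇒≤; suc-injective)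
open import Data.Fin.Subset using (∣_∣) renaming (_∈_ to _∈ₛ_)
open import Data.Fin.Subset.Properties using (∣p∣≤n)
open import Data.Integer using (+[1+_])
open import Data.List as List using (List; []; _∷_; _++_; map; length; cartesianProductWith; cartesianProduct; concatMap; tabulate; allFin; upTo)
open import Data.List.Properties using (length-map; ++-identityʳ)
open import Data.List.Membership.Propositional using (_∈_; lose)
open import Data.List.Membership.Propositional.Properties
open import Data.List.Relation.Unary.Any using (here; there; index)
open import Data.List.Relation.Unary.Any.Properties using (lookup-index)
open import Data.Rational using (mkℚ; Positive; positive; 0ℚ; 1ℚ; _+_; _*_; _-_; -_; 1/_; _⊔_; _<_; _<?_)
open import Data.Rational.Properties
open import Data.Rational.Solver using (module +-*-Solver)
open import Data.Sum using (_⊎_; inj₁; inj₂; [_,_]′)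
open import Data.Unit using (⊤; tt)
open import Data.Vec using (tail)
import Data.Vec.Functional as VF
open import Algebra.Properties.CommutativeSemiring.Exp
  (CommutativeRing.commutativeSemiring +-*-commutativeRing) using (_^_; ^-homo-*; ^-distrib-*)
open +-*-Solver

-- Ring identities over the rationals.

private
  ring-refocus₁ : ∀ A B u v → A + B + - u + v ≡ A + (v - u) + B
  ring-refocus₁ = solve 4 (λ A B u v → A :+ B :+ :- u :+ v := A :+ (v :- u) :+ B) refl
  ring-refocus₂ : ∀ A B u v w → A + B + - u + v ≡ A + (v - w - u) + (B + w)
  ring-refocus₂ = solve 5 (λ A B u v w → A :+ B :+ :- u :+ v := A :+ (v :- w :- u) :+ (B :+ w)) refl
  ring-0 : ∀ a → 0ℚ ≡ 0ℚ * a + 0ℚ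
  ring-0 = solve 1 (λ a → con 0ℚ := con 0ℚ :* a :+ con 0ℚ) refl
  ring-+ : ∀ c a g d h → (c * a + g) + (d * a + h) ≡ (c + d) * a + (g + h)
  ring-+ = solve 5 (λ c a g d h → (c :* a :+ g) :+ (d :* a :+ h) := (c :+ d) :* a :+ (g :+ h)) refl
  ring-* : ∀ k c a g → k * (c * a + g) ≡ (k * c) * a + k * g
  ring-* = solve 4 (λ k c a g → k :* (c :* a :+ g) := (k :* c) :* a :+ k :* g) refl
  ring-up : ∀ a g → g ≡ 0ℚ * a + g
  ring-up = solve 2 (λ a g → g := con 0ℚ :* a :+ g) refl
  ring-t : ∀ t c a g → t * (c * a + g) ≡ c * (t * a) + t * g
  ring-t = solve 4 (λ t c a g → t :* (c :* a :+ g) := c :* (t :* a) :+ t :* g) refl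
  ring-mono : ∀ c a → c * a ≡ c * a + 0ℚ
  ring-mono = solve 2 (λ c a → c :* a := c :* a :+ con 0ℚ) refl
  ring-shift₀ : ∀ c t d → c * ((t + d) * 1ℚ) - c * (d * 1ℚ) - c * (t * 1ℚ) ≡ 0ℚ
  ring-shift₀ = solve 3 (λ c t d → c :* ((t :+ d) :* con 1ℚ) :- c :* (d :* con 1ℚ) :- c :* (t :* con 1ℚ) := con 0ℚ) refl
  ring-shift : ∀ c t d u v w → c * ((t + d) * u) - c * (d * v) - c * (t * w)
    ≡ (t * (c * u - c * v - c * w) + d * (c * u - c * v - c * w)) + (v * (c * (t * 1ℚ)) + d * (c * w))
  ring-shift = solve 6 (λ c t d u v w → c :* ((t :+ d) :* u) :- c :* (d :* v) :- c :* (t :* w)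
    := (t :* (c :* u :- c :* v :- c :* w) :+ d :* (c :* u :- c :* v :- c :* w)) :+ (v :* (c :* (t :* con 1ℚ)) :+ d :* (c :* w))) refl
  ring-head : ∀ c u v w g h → (c * u + g) - (c * v + h) ≡ c * w + ((c * u - c * v - c * w) + (g - h))
  ring-head = solve 6 (λ c u v w g h → (c :* u :+ g) :- (c :* v :+ h) := c :* w :+ ((c :* u :- c :* v :- c :* w) :+ (g :- h))) refl
  ring-min₁ : ∀ c a g d b → (c * a + g) - d * b ≡ c * a + (g - d * b)
  ring-min₁ = solve 5 (λ c a g d b → (c :* a :+ g) :- d :* b := c :* a :+ (g :- d :* b)) refl
  ring-min₂ : ∀ c a g → (c * a + g) - c * a ≡ g
  ring-min₂ = solve 3 (λ c a g → (c :* a :+ g) :- c :* a := g) refl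
  ring-min₃ : ∀ c a g d → (c * a + g) - d * a ≡ (c - d) * a + g
  ring-min₃ = solve 4 (λ c a g d → (c :* a :+ g) :- d :* a := (c :- d) :* a :+ g) refl
  ring-neg : ∀ a → - a ≡ - 1ℚ * a
  ring-neg = solve 1 (λ a → :- a := :- con 1ℚ :* a) refl
  ring-pow : ∀ k c s t g → k * (c * (s * t) + g) ≡ (k * (c * s)) * t + k * g
  ring-pow = solve 5 (λ k c s t g → k :* (c :* (s :* t) :+ g) := (k :* (c :* s)) :* t :+ k :* g) refl
  ring-arg : ∀ c s t g → c * (s * t) + g ≡ (t * c) * s + g
  ring-arg = solve 4 (λ c s t g → c :* (s :* t) :+ g := (t :* c) :* s :+ g) refl
  ring-coef : ∀ k c s → k * (c * s) ≡ c * (s * k)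
  ring-coef = solve 3 (λ k c s → k :* (c :* s) := c :* (s :* k)) refl
  ring-q : ∀ A T D B q z → (A * T) * (((D * B) * q) * z) ≡ (A * B) * (D * (T * (q * z)))
  ring-q = solve 6 (λ A T D B q z → (A :* T) :* (((D :* B) :* q) :* z) := (A :* B) :* (D :* (T :* (q :* z)))) refl
  ring-n : ∀ A T B q z → (A * T) * ((B * q) * z) ≡ (A * B) * (T * (q * z))
  ring-n = solve 5 (λ A T B q z → (A :* T) :* ((B :* q) :* z) := (A :* B) :* (T :* (q :* z))) refl
  ring-κ : ∀ T q z κ v → T * (q * (z + κ * v)) ≡ T * (q * z) + ((T * q) * κ) * v
  ring-κ = solve 5 (λ T q z κ v → T :* (q :* (z :+ κ :* v)) := T :* (q :* z) :+ ((T :* q) :* κ) :* v) refl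
  ring-1 : ∀ q → 1ℚ - q + q ≡ 1ℚ
  ring-1 = solve 1 (λ q → con 1ℚ :- q :+ q := con 1ℚ) refl
  ring-prod : ∀ s y t p → (s * y) * (t * p) ≡ (s * t) * (y * p)
  ring-prod = solve 4 (λ s y t p → (s :* y) :* (t :* p) := (s :* t) :* (y :* p)) refl
  ring-lead : ∀ e a p t m → (e * a) * (p * (t * m)) ≡ (e * (p * m)) * (t * a)
  ring-lead = solve 5 (λ e a p t m → (e :* a) :* (p :* (t :* m)) := (e :* (p :* m)) :* (t :* a)) refl
  ring-add : ∀ α u κ v → α * (u + κ * v) ≡ α * u + (α * κ) * v
  ring-add = solve 4 (λ α u κ v → α :* (u :+ κ :* v) := α :* u :+ (α :* κ) :* v) refl
  ring-swap : ∀ e t y → e * (t * y) ≡ (t * e) * y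
  ring-swap = solve 3 (λ e t y → e :* (t :* y) := (t :* e) :* y) refl
  ring-swap₃ : ∀ a b c → a * (b * c) ≡ b * (a * c)
  ring-swap₃ = solve 3 (λ a b c → a :* (b :* c) := b :* (a :* c)) refl
  ring-swap₊ : ∀ a b c → a + (b + c) ≡ b + (a + c)
  ring-swap₊ = solve 3 (λ a b c → a :+ (b :+ c) := b :+ (a :+ c)) refl

-- The polynomial van der Waerden theorem, uniform in the coefficients

-- A rational vector space of functions of the parameters. Positions are sought inside it: when it
-- is `polynomials`, they stay polynomial in an outer scale.
record Submodule (X : Set) : Set₁ where
  field
    Mem : (X → ℚ) → Set
    mem-ext : ∀ {f g} → (∀ x → f x ≡ g x) → Mem f → Mem g
    mem-0 : Mem (λ _ → 0ℚ)
    mem-+ : ∀ {f g} → Mem f → Mem g → Mem (λ x → f x + g x)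
    mem-* : ∀ k {f} → Mem f → Mem (λ x → k * f x)

  mem-neg : ∀ {f} → Mem f → Mem (λ x → - f x)
  mem-neg {f} m = mem-ext (λ x → sym (ring-neg (f x))) (mem-* (- 1ℚ) m)

Some : {A : Set} → List A → (A → Set) → Set
Some xs Q = Σ _ λ a → a ∈ xs × Q a

Family : Set → Set
Family X = List (X → ℚ → ℚ)

module _ {X : Set} (M : Submodule X) where
  open Submodule M

  -- The position may depend on the parameters, but the difference is a constant, so all differences
  -- that can occur are known before `x` and can enter `derive`.
  record Cand : Set where
    constructor cand
    field
      pos : X → ℚ
      pos-mem : Mem pos
      dif : ℚ
      dif>0 : Positive dif
  open Cand public

  Solves : ∀ {r} → Family X → X → (ℚ → Fin r) → Cand → Set
  Solves P x C s = ∀ p → p ∈ P → C (pos s x + p x (dif s)) ≡ C (pos s x)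

  -- The list of candidates is chosen before x and C: this uniformity is what the inductions consume.
  PvdW : Family X → Set
  PvdW P = ∀ r → Σ (List Cand) λ cs → ∀ x (C : ℚ → Fin r) → Some cs (Solves P x C)

module _ {X : Set} {M : Submodule X} where
  open Submodule M

  -- The colourings indexed by `W` are merged into one product colouring with `r ^ length W`
  -- colours.
  PvdW-multi : ∀ {P} → PvdW M P → ∀ r {Y : Set} (W : List Y) →
    Σ (List (Cand M)) λ cs → ∀ x (C : Y → ℚ → Fin r) →
      Some cs λ s → ∀ y → y ∈ W → Solves M P x (C y) s
  PvdW-multi {P} V r W = proj₁ (V (r ℕ.^ length W)) , hit
    where
    hit : ∀ x (C : _ → ℚ → Fin r) → Some (proj₁ (V (r ℕ.^ length W))) λ s → ∀ y → y ∈ W → Solves M P x (C y) s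
    hit x C = let s , s∈ , sol = proj₂ (V (r ℕ.^ length W)) x (λ z → funToFin (λ i → C (List.lookup W i) z)) in
      s , s∈ , λ y y∈ p p∈ →
      subst (λ u → C u (pos s x + p x (dif s)) ≡ C u (pos s x)) (sym (lookup-index y∈))
        (trans (sym (finToFun-funToFin _ (index y∈)))
          (trans (cong (λ k → finToFun k (index y∈)) (sol p p∈)) (finToFun-funToFin _ (index y∈))))

  -- Colour focusing.

  minus : (X → ℚ → ℚ) → (X → ℚ → ℚ) → X → ℚ → ℚ
  minus p₁ p x t = p x t - p₁ x t

  shift-minus : (X → ℚ → ℚ) → ℚ → (X → ℚ → ℚ) → X → ℚ → ℚ
  shift-minus p₁ d p x t = p x (t + d) - p x d - p₁ x t

  -- These are the displacements between old and new points when the apex is moved back by `p₁` of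
  -- the new difference; `D` holds the old differences.
  derive : (X → ℚ → ℚ) → List ℚ → Family X → Family X
  derive p₁ D P = map (minus p₁) P ++ cartesianProductWith (shift-minus p₁) D P

  record Foc (s : ℕ) : Set where
    constructor foc
    field
      apex : X → ℚ
      apex-mem : Mem apex
      difs : Fin s → ℚ
      difs>0 : ∀ i → Positive (difs i)
  open Foc

  Focused : ∀ {r s} → Family X → X → (ℚ → Fin r) → Foc s → Set
  Focused {r} {s} P x C f = Σ (Fin s → Fin r) λ cs →
    (∀ i p → p ∈ P → C (apex f x + p x (difs f i)) ≡ cs i) × (∀ {i j} → cs i ≡ cs j → i ≡ j)

  -- Either the family is solved or `s` spokes of distinct colours meet in one apex. With more
  -- spokes than colours only the first case remains.
  Focusing : ℕ → ℕ → Family X → Set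
  Focusing r s P = Σ (List (Cand M)) λ cs → Σ (List (Foc s)) λ fs → ∀ x (C : ℚ → Fin r) →
    Some cs (Solves M P x C) ⊎ Some fs (Focused P x C)

  focusing-zero : ∀ {r P} → Focusing r 0 P
  focusing-zero = [] , foc (λ _ → 0ℚ) mem-0 (λ ()) (λ ()) ∷ [] ,
    λ x C → inj₂ (_ , here refl , (λ ()) , (λ ()) , λ { {()} })

  module FocusingStep {P : Family X} {p₁ : X → ℚ → ℚ} (p₁-mem : ∀ t → Mem (λ x → p₁ x t))
    (V : ∀ D → PvdW M (derive p₁ D P)) where

    module _ {r s : ℕ} (F : Focusing r s P) where
      old : List (Cand M)
      old = proj₁ F

      focs : List (Foc s)
      focs = proj₁ (proj₂ F)

      D : List ℚ
      D = concatMap (λ f → tabulate (difs f)) focs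

      offset : Foc s → Fin s → (X → ℚ → ℚ) → X → ℚ
      offset f i p x = apex f x + p x (difs f i)

      offsetsOf : Foc s → List (X → ℚ)
      offsetsOf f = apex f ∷ cartesianProductWith (offset f) (allFin s) P

      -- Every old apex and every point on an old spoke has to keep its colour under the shift; each
      -- contributes one translated colouring.
      offsets : List (X → ℚ)
      offsets = concatMap offsetsOf focs

      shifts : List (Cand M)
      shifts = proj₁ (PvdW-multi (V D) r offsets)

      shiftCand : Cand M → Cand M → Cand M
      shiftCand b a = cand _ (mem-+ (pos-mem b) (pos-mem a)) (dif a) (dif>0 a)

      -- For the case that the apex has the colour of spoke `i`: the difference of that spoke then
      -- solves the family at the apex.
      collision : Cand M → Foc s → Fin s → Cand M
      collision b f i = cand _ (mem-+ (pos-mem b) (apex-mem f)) (difs f i) (difs>0 f i)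

      new : List (Cand M)
      new = cartesianProductWith shiftCand shifts old
        ++ concatMap (λ b → cartesianProductWith (collision b) focs (allFin s)) shifts

      -- Moving the apex back by `p₁` turns invariance under `derive` into constant colour along
      -- each spoke: the old spokes are lengthened by `dif b`, and the extra spoke takes its colour
      -- from the old apex.
      refocus : Cand M → Foc s → Foc (suc s)
      refocus b f = foc _ (mem-+ (mem-+ (pos-mem b) (apex-mem f)) (mem-neg (p₁-mem (dif b))))
        (λ { zero → dif b ; (suc i) → dif b + difs f i })
        (λ { zero → dif>0 b
           ; (suc i) → pos+pos⇒pos (dif b) {{dif>0 b}} (difs f i) {{difs>0 f i}} })

      refocused : List (Foc (suc s))
      refocused = cartesianProductWith refocus shifts focs

      module _ (x : X) (C : ℚ → Fin r) (b : Cand M) (b∈ : b ∈ shifts)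
        (inv : ∀ y → y ∈ offsets → Solves M (derive p₁ D P) x (λ z → C (z + y x)) b) where

        lift-old : Some old (Solves M P x (λ z → C (pos b x + z))) → Some new (Solves M P x C)
        lift-old (a , a∈ , sol) = shiftCand b a ,
          ∈-++⁺ˡ (∈-cartesianProductWith⁺ shiftCand b∈ a∈) ,
          λ p p∈ → trans (cong C (+-assoc (pos b x) (pos a x) _)) (sol p p∈)

        lift-foc : (F : Some focs (Focused P x (λ z → C (pos b x + z)))) →
          Dec (∃ λ i → proj₁ (proj₂ (proj₂ F)) i ≡ C (pos b x + apex (proj₁ F) x)) →
          Some new (Solves M P x C) ⊎ Some refocused (Focused P x C)
        lift-foc (f , f∈ , cs , mono , inj) (yes (i , csᵢ≡)) = inj₁ (collision b f i ,
          ∈-++⁺ʳ (cartesianProductWith shiftCand shifts old)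
            (∈-concatMap⁺ (λ b → cartesianProductWith (collision b) focs (allFin s)) {xs = shifts}
              (lose b∈ (∈-cartesianProductWith⁺ (collision b) f∈ (∈-allFin i)))) ,
          λ p p∈ → trans (cong C (+-assoc (pos b x) (apex f x) _)) (trans (mono i p p∈) csᵢ≡))
        lift-foc (f , f∈ , cs , mono , inj) (no ¬csᵢ≡) = inj₂ (refocus b f , ∈-cartesianProductWith⁺ refocus b∈ f∈ ,
          cs′ , mono′ , λ {i} {j} → inj′ i j)
          where
          e = dif b
          A = pos b x
          B = apex f x

          cs′ : Fin (suc s) → Fin r
          cs′ zero = C (A + B)
          cs′ (suc i) = cs i

          apex∈ : apex f ∈ offsets
          apex∈ = ∈-concatMap⁺ offsetsOf {xs = focs} (lose f∈ (here refl))

          shifted∈ : ∀ i p → p ∈ P → offset f i p ∈ offsets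
          shifted∈ i p p∈ = ∈-concatMap⁺ offsetsOf {xs = focs} (lose f∈ (there
            (∈-cartesianProductWith⁺ (offset f) (∈-allFin i) p∈)))

          difs∈ : ∀ i → difs f i ∈ D
          difs∈ i = ∈-concatMap⁺ (λ f → tabulate (difs f)) {xs = focs} (lose f∈ (∈-tabulate⁺ i))

          mono′ : ∀ i p → p ∈ P → C (apex (refocus b f) x + p x (difs (refocus b f) i)) ≡ cs′ i
          mono′ zero p p∈ = trans
            (cong C (ring-refocus₁ A B (p₁ x e) (p x e)))
            (inv (apex f) apex∈ (minus p₁ p) (∈-++⁺ˡ (∈-map⁺ (minus p₁) p∈)))
          mono′ (suc i) p p∈ = trans
            (cong C (ring-refocus₂ A B (p₁ x e) (p x (e + difs f i)) (p x (difs f i))))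
            (trans (inv (offset f i p) (shifted∈ i p p∈) (shift-minus p₁ (difs f i) p)
                (∈-++⁺ʳ (map (minus p₁) P)
                  (∈-cartesianProductWith⁺ (shift-minus p₁) (difs∈ i) p∈)))
              (mono i p p∈))

          inj′ : ∀ i j → cs′ i ≡ cs′ j → i ≡ j
          inj′ zero zero _ = refl
          inj′ zero (suc j) eq = contradiction (j , sym eq) ¬csᵢ≡
          inj′ (suc i) zero eq = contradiction (i , eq) ¬csᵢ≡
          inj′ (suc i) (suc j) eq = cong suc (inj eq)

      focusing-suc : Focusing r (suc s) P
      focusing-suc = new , refocused , hit
        where
        hit : ∀ x C → Some new (Solves M P x C) ⊎ Some refocused (Focused P x C)
        hit x C = let b , b∈ , inv = proj₂ (PvdW-multi (V D) r offsets) x (λ y z → C (z + y x)) in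
          [ inj₁ ∘ lift-old x C b b∈ inv
          , (λ F → lift-foc x C b b∈ inv F (any? λ i → proj₁ (proj₂ (proj₂ F)) i Fin.≟ _))
          ]′ (proj₂ (proj₂ F) x (λ z → C (pos b x + z)))

    focusing : ∀ r s → Focusing r s P
    focusing r zero = focusing-zero
    focusing r (suc s) = focusing-suc (focusing r s)

    PvdW-step : PvdW M P
    PvdW-step r = proj₁ (focusing r (suc r)) , hit
      where
      hit : ∀ x C → Some (proj₁ (focusing r (suc r))) (Solves M P x C)
      hit x C = [ id , (λ (_ , _ , cs , _ , inj) →
        let i , j , i<j , eq = pigeonhole (n<1+n r) cs in contradiction (inj eq) (Fin.<⇒≢ i<j)) ]′
        (proj₂ (proj₂ (focusing r (suc r))) x C)

-- Polynomials without constant term.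

module _ {X : Set} (M : Submodule X) where
  open Submodule M

  -- The degree is at most `n`: leading coefficients may vanish, which spares any test for zero.
  Pol : ℕ → (X → ℚ → ℚ) → Set
  Pol zero f = ∀ x t → f x t ≡ 0ℚ
  Pol (suc n) f = Σ (X → ℚ) λ c → Σ (X → ℚ → ℚ) λ g →
    Mem c × Pol n g × (∀ x t → f x t ≡ c x * t ^ suc n + g x t)

module _ {X : Set} {M : Submodule X} where
  open Submodule M

  pol-ext : ∀ n {f g} → (∀ x t → g x t ≡ f x t) → Pol M n f → Pol M n g
  pol-ext zero eq p x t = trans (eq x t) (p x t)
  pol-ext (suc n) eq (c , g , m , p , f≡) = c , g , m , p , λ x t → trans (eq x t) (f≡ x t)

  pol-0 : ∀ n → Pol M n (λ _ _ → 0ℚ)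
  pol-0 zero x t = refl
  pol-0 (suc n) = _ , _ , mem-0 , pol-0 n , λ x t → ring-0 (t ^ suc n)

  pol-+ : ∀ n {f g} → Pol M n f → Pol M n g → Pol M n (λ x t → f x t + g x t)
  pol-+ zero p q x t = cong₂ _+_ (p x t) (q x t)
  pol-+ (suc n) (c , f , m , p , f≡) (d , g , m′ , q , g≡) = _ , _ , mem-+ m m′ , pol-+ n p q ,
    λ x t → trans (cong₂ _+_ (f≡ x t) (g≡ x t)) (ring-+ (c x) (t ^ suc n) (f x t) (d x) (g x t))

  pol-* : ∀ n k {f} → Pol M n f → Pol M n (λ x t → k * f x t)
  pol-* zero k p x t = trans (cong (k *_) (p x t)) (*-zeroʳ k)
  pol-* (suc n) k (c , f , m , p , f≡) = _ , _ , mem-* k m , pol-* n k p ,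
    λ x t → trans (cong (k *_) (f≡ x t)) (ring-* k (c x) (t ^ suc n) (f x t))

  pol-- : ∀ n {f g} → Pol M n f → Pol M n g → Pol M n (λ x t → f x t - g x t)
  pol-- n {f} {g} p q = pol-+ n p (pol-ext n (λ x t → ring-neg (g x t)) (pol-* n (- 1ℚ) q))

  pol-suc : ∀ n {f} → Pol M n f → Pol M (suc n) f
  pol-suc n {f} p = _ , _ , mem-0 , p , λ x t → ring-up (t ^ suc n) (f x t)

  pol-≤ : ∀ {m n f} → m ℕ.≤ n → Pol M m f → Pol M n f
  pol-≤ m≤n = go (ℕ.≤⇒≤′ m≤n)
    where
    go : ∀ {m n f} → m ℕ.≤′ n → Pol M m f → Pol M n f
    go ℕ.≤′-refl p = p
    go (ℕ.≤′-step {n} m≤n) p = pol-suc n (go m≤n p)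

  pol-t* : ∀ n {f} → Pol M n f → Pol M (suc n) (λ x t → t * f x t)
  pol-t* zero p = pol-suc zero λ x t → trans (cong (t *_) (p x t)) (*-zeroʳ t)
  pol-t* (suc n) (c , f , m , p , f≡) = _ , _ , m , pol-t* n p ,
    λ x t → trans (cong (t *_) (f≡ x t)) (ring-t t (c x) (t ^ suc n) (f x t))

  pol-mono : ∀ n {c} → Mem c → Pol M (suc n) (λ x t → c x * t ^ suc n)
  pol-mono n {c} m = c , _ , m , pol-0 n , λ x t → ring-mono (c x) (t ^ suc n)

  -- Only the mixed terms of the binomial expansion survive, so the degree drops and no constant
  -- term appears.
  pol-mono-shift : ∀ n d {c} → Mem c →
    Pol M n (λ x t → c x * (t + d) ^ suc n - c x * d ^ suc n - c x * t ^ suc n)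
  pol-mono-shift zero d {c} m x t = ring-shift₀ (c x) t d
  pol-mono-shift (suc n) d {c} m = pol-ext (suc n)
    (λ x t → ring-shift (c x) t d ((t + d) ^ suc n) (d ^ suc n) (t ^ suc n))
    (pol-+ (suc n)
      (pol-+ (suc n) (pol-t* n rec) (pol-suc n (pol-* n d rec)))
      (pol-+ (suc n) (pol-* (suc n) (d ^ suc n) (pol-≤ (ℕ.s≤s ℕ.z≤n) (pol-mono 0 m)))
        (pol-* (suc n) d (pol-mono n m))))
    where rec = pol-mono-shift n d m

  shift : ℚ → (X → ℚ → ℚ) → X → ℚ → ℚ
  shift d p x t = p x (t + d) - p x d

  -- PET induction on leading terms.

  Head : Set
  Head = ℕ × Σ (X → ℚ) Mem

  HasHead : Head → (X → ℚ → ℚ) → Set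
  HasHead (n , c , _) p = Σ (X → ℚ → ℚ) λ g → Pol M n g × (∀ x t → p x t ≡ c x * t ^ suc n + g x t)

  pol-shift : ∀ n d {f} → Pol M n f → Pol M n (shift d f)
  pol-shift zero d p x t = cong₂ _-_ (p x (t + d)) (p x d)
  pol-shift (suc n) d (c , g , m , p , f≡) =
    c , _ , m , pol-+ n (pol-mono-shift n d m) (pol-shift n d p) ,
    λ x t → trans (cong₂ _-_ (f≡ x (t + d)) (f≡ x d))
      (ring-head (c x) ((t + d) ^ suc n) (d ^ suc n) (t ^ suc n) (g x (t + d)) (g x d))

  -- A shift changes only lower terms, so the many shifts in `derive` create no new heads; PET
  -- induction counts heads, not polynomials.
  head-shift : ∀ h d {p} → HasHead h p → HasHead h (shift d p)
  head-shift (n , c , m) d (g , q , p≡) =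
    let _ , g′ , _ , q′ , eq = pol-shift (suc n) d (c , g , m , q , p≡) in g′ , q′ , eq

  Member : List Head → (X → ℚ → ℚ) → Set
  Member H p = Some H λ h → HasHead h p

  Good : List Head → Set
  Good H = ∀ P → (∀ p → p ∈ P → Member H p) → PvdW M P

  member-++ˡ : ∀ {H} H′ {p} → Member H p → Member (H ++ H′) p
  member-++ˡ H′ (h , h∈ , q) = h , ∈-++⁺ˡ h∈ , q

  subHead : Σ (X → ℚ) Mem → Σ (X → ℚ) Mem → Σ (X → ℚ) Mem
  subHead (c , m) (d , m′) = (λ x → d x - c x) , mem-+ m′ (mem-neg m)

  monomial : ℕ → Σ (X → ℚ) Mem → X → ℚ → ℚ
  monomial j (c , _) x t = c x * t ^ suc j

  Above : ℕ → List Head → Set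
  Above j H = ∀ h → h ∈ H → j ℕ.< proj₁ h

  -- Heads above degree `suc j` are unaffected, the others of degree `suc j` have `c` subtracted,
  -- and the head `c` falls to degree at most `j`: one head fewer at this degree.
  member-minus : ∀ j H c K → Above j H → ∀ {p} → Member (H ++ map (j ,_) (c ∷ K)) p →
    Member (H ++ map (j ,_) (map (subHead c) K)) (minus {M = M} (monomial j c) p)
      ⊎ Pol M j (minus {M = M} (monomial j c) p)
  member-minus j H c K H>j {p} (h , h∈ , q) = [ inH h q , inK h q ∘ ∈-map⁻ (j ,_) ]′ (∈-++⁻ H h∈)
    where
    Goal : Set
    Goal = Member (H ++ map (j ,_) (map (subHead c) K)) (minus {M = M} (monomial j c) p)
      ⊎ Pol M j (minus {M = M} (monomial j c) p)
    inH : ∀ h → HasHead h p → h ∈ H → Goal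
    inH h@(n , d , m) (g , q , p≡) h∈ = inj₁ (h , ∈-++⁺ˡ h∈ , _ ,
      pol-- n q (pol-≤ (H>j h h∈) (pol-mono j (proj₂ c))) ,
      λ x t → trans (cong (_- monomial j c x t) (p≡ x t))
        (ring-min₁ (d x) (t ^ suc n) (g x t) (proj₁ c x) (t ^ suc j)))
    inK : ∀ h → HasHead h p → (∃ λ d → d ∈ c ∷ K × h ≡ (j , d)) → Goal
    inK _ (g , q , p≡) (d , here refl , refl) = inj₂ (pol-ext j
      (λ x t → trans (cong (_- monomial j c x t) (p≡ x t)) (ring-min₂ (proj₁ c x) (t ^ suc j) (g x t))) q)
    inK _ (g , q , p≡) (d , there d∈ , refl) = inj₁ ((j , subHead c d) ,
      ∈-++⁺ʳ H (∈-map⁺ (j ,_) (∈-map⁺ (subHead c) d∈)) , g , q ,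
      λ x t → trans (cong (_- monomial j c x t) (p≡ x t))
        (ring-min₃ (proj₁ d x) (t ^ suc j) (g x t) (proj₁ c x)))

  good-[] : Good []
  good-[] [] _ r = cand (λ _ → 0ℚ) mem-0 1ℚ _ ∷ [] , λ x C → _ , here refl , λ _ ()
  good-[] (p ∷ P) m = contra (m p (here refl))
    where
    contra : ∀ {A : Set} {p} → Member [] p → A
    contra (_ , () , _)

  drop-zero : ∀ {H} P → (∀ p → p ∈ P → Member H p ⊎ Pol M 0 p) →
    Σ (Family X) λ Q → (∀ p → p ∈ Q → Member H p) ×
      (∀ {r} x (C : ℚ → _) s → Solves M {r} Q x C s → Solves M P x C s)
  drop-zero [] m = [] , (λ _ ()) , λ _ _ _ _ _ ()
  drop-zero {H} (p ∷ P) m = add (drop-zero P (λ p → m p ∘ there)) (m p (here refl))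
    where
    Result : Family X → Set
    Result P = Σ (Family X) λ Q → (∀ p → p ∈ Q → Member H p) ×
      (∀ {r} x (C : ℚ → _) s → Solves M {r} Q x C s → Solves M P x C s)
    add : Result P → Member H p ⊎ Pol M 0 p → Result (p ∷ P)
    add (Q , mem , imp) (inj₁ q) = p ∷ Q ,
      (λ { _ (here refl) → q ; p (there p∈) → mem p p∈ }) ,
      λ { x C s sol _ (here refl) → sol p (here refl)
        ; x C s sol p′ (there p∈) → imp x C s (λ q q∈ → sol q (there q∈)) p′ p∈ }
    add (Q , mem , imp) (inj₂ z) = Q , mem ,
      λ { x C s sol _ (here refl) →
            cong C (trans (cong (pos s x +_) (z x (dif s))) (+-identityʳ (pos s x)))
        ; x C s sol p′ (there p∈) → imp x C s sol p′ p∈ }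

  collect : ∀ {H} i P → (∀ p → p ∈ P → Member H p ⊎ Pol M (suc i) p) →
    Σ (List (Σ (X → ℚ) Mem)) λ K → ∀ p → p ∈ P → Member (H ++ map (i ,_) K) p
  collect i [] m = [] , λ _ ()
  collect {H} i (p ∷ P) m = add (collect i P (λ p → m p ∘ there)) (m p (here refl))
    where
    Result : Family X → Set
    Result P = Σ (List (Σ (X → ℚ) Mem)) λ K → ∀ p → p ∈ P → Member (H ++ map (i ,_) K) p
    weaken : ∀ {k K p} → Member (H ++ map (i ,_) K) p → Member (H ++ map (i ,_) (k ∷ K)) p
    weaken (h , h∈ , q) = h , [ ∈-++⁺ˡ , ∈-++⁺ʳ H ∘ there ]′ (∈-++⁻ H h∈) , q
    add : Result P → Member H p ⊎ Pol M (suc i) p → Result (p ∷ P)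
    add (K , mem) (inj₁ q) = K , λ { _ (here refl) → member-++ˡ _ q ; p (there p∈) → mem p p∈ }
    add (K , mem) (inj₂ (c , g , m , q , p≡)) = (c , m) ∷ K ,
      λ { _ (here refl) → (i , c , m) , ∈-++⁺ʳ H (here refl) , g , q , p≡
        ; p (there p∈) → weaken (mem p p∈) }

  -- The two functions descend lexicographically. Here the heads of the top degree still to be
  -- treated are collected; `good-extend` removes them one at a time, falling back on arbitrary
  -- polynomials of lower degree.
  good-lower : ∀ j H → (∀ h → h ∈ H → j ℕ.≤ proj₁ h) → Good H →
    ∀ P → (∀ p → p ∈ P → Member H p ⊎ Pol M j p) → PvdW M P
  good-extend : ∀ j m K → length K ≡ m → ∀ H → Above j H → Good H → Good (H ++ map (j ,_) K)

  good-lower zero H _ g P m r =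
    let Q , mem , imp = drop-zero P m
        cs , hit = g Q mem r
    in cs , λ x C → let s , s∈ , sol = hit x C in s , s∈ , imp x C s sol
  good-lower (suc i) H H≥ g P m =
    let K , mem = collect i P m in good-extend i (length K) K refl H H≥ g P mem

  good-extend j m [] eq H H>j g = subst Good (sym (++-identityʳ H)) g
  -- The subtracted polynomial is the leading monomial of a head of the lowest degree listed.
  -- Induction is on the length because `subHead c` rewrites `K`.
  good-extend j (suc m) (c ∷ K) eq H H>j g P mem = FocusingStep.PvdW-step {p₁ = monomial j c}
    (λ t → mem-ext (λ x → *-comm (t ^ suc j) (proj₁ c x)) (mem-* (t ^ suc j) (proj₂ c)))
    (λ D → good-lower j H′ H′≥ good′ (derive {M = M} (monomial j c) D P) (derived D))
    where
    H′ = H ++ map (j ,_) (map (subHead c) K)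

    good′ : Good H′
    good′ = good-extend j m (map (subHead c) K)
      (trans (length-map (subHead c) K) (ℕ.suc-injective eq)) H H>j g

    H′≥ : ∀ h → h ∈ H′ → j ℕ.≤ proj₁ h
    H′≥ h h∈ = [ ℕ.<⇒≤ ∘ H>j h , (λ h∈ → ℕ.≤-reflexive (sym (cong proj₁ (proj₂ (proj₂ (∈-map⁻ (j ,_) h∈)))))) ]′
      (∈-++⁻ H h∈)

    derived : ∀ D q → q ∈ derive {M = M} (monomial j c) D P → Member H′ q ⊎ Pol M j q
    derived D q q∈ = [ (λ q∈ → plain (∈-map⁻ _ q∈)) , (λ q∈ → shifted (∈-cartesianProductWith⁻ _ D P q∈)) ]′
      (∈-++⁻ (map (minus {M = M} (monomial j c)) P) q∈)
      where
      plain : ∀ {q} → (∃ λ p → p ∈ P × q ≡ minus {M = M} (monomial j c) p) → Member H′ q ⊎ Pol M j q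
      plain (p , p∈ , refl) = member-minus j H c K H>j (mem p p∈)
      shifted : ∀ {q} → (∃ λ d → ∃ λ p → d ∈ D × p ∈ P × q ≡ shift-minus {M = M} (monomial j c) d p) →
        Member H′ q ⊎ Pol M j q
      shifted (d , p , _ , p∈ , refl) = let h , h∈ , q = mem p p∈ in
        member-minus j H c K H>j (h , h∈ , head-shift h d q)

  IsPol : (X → ℚ → ℚ) → Set
  IsPol p = ∃ λ n → Pol M n p

  polynomial-vdW : ∀ P → (∀ p → p ∈ P → IsPol p) → PvdW M P
  polynomial-vdW P m = let n , m′ = bound P m in
    good-lower n [] (λ _ ()) good-[] P (λ p p∈ → inj₂ (m′ p p∈))
    where
    bound : ∀ P → (∀ p → p ∈ P → IsPol p) → ∃ λ n → ∀ p → p ∈ P → Pol M n p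
    bound [] m = 0 , λ _ ()
    bound (p ∷ P) m = let n , q = m p (here refl) ; n′ , m′ = bound P (λ p → m p ∘ there) in
      n ℕ.⊔ n′ , λ { _ (here refl) → pol-≤ (ℕ.m≤m⊔n n n′) q
                   ; p (there p∈) → pol-≤ (ℕ.m≤n⊔m n n′) (m′ p p∈) }

-- Simultaneous recurrence at all powers of one scale

inverse : ∀ e → Positive e → Σ ℚ λ σ → Positive σ × e * σ ≡ 1ℚ
inverse e e>0 = (1/ e) {{pos⇒nonZero e {{e>0}}}} , 1/pos⇒pos e {{e>0}} , *-inverseʳ e {{pos⇒nonZero e {{e>0}}}}

pow>0 : ∀ {e} → Positive e → ∀ n → Positive (e ^ n)
pow>0 e>0 zero = _
pow>0 {e} e>0 (suc n) = pos*pos⇒pos e {{e>0}} (e ^ n) {{pow>0 e>0 n}}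

one-pow : ∀ n → 1ℚ ^ n ≡ 1ℚ
one-pow zero = refl
one-pow (suc n) = trans (*-identityˡ (1ℚ ^ n)) (one-pow n)

pow-inverse : ∀ {e σ} → e * σ ≡ 1ℚ → ∀ n → e ^ n * σ ^ n ≡ 1ℚ
pow-inverse {e} {σ} eq n = trans (sym (^-distrib-* e σ n)) (trans (cong (_^ n) eq) (one-pow n))

pow-split : ∀ σ {i n} → i ℕ.≤ n → σ ^ n ≡ σ ^ (n ∸ i) * σ ^ i
pow-split σ {i} {n} i≤n = trans (cong (σ ^_) (sym (ℕ.m∸n+n≡m i≤n))) (^-homo-* σ (n ∸ i) i)

1*-elim : ∀ {u} v → u ≡ 1ℚ → u * v ≡ v
1*-elim v eq = trans (cong (_* v) eq) (*-identityˡ v)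

module _ {X : Set} {M : Submodule X} where
  open Submodule M

  pol-arg : ∀ n τ {p} → Pol M n p → Pol M n (λ x s → p x (s * τ))
  pol-arg zero τ p x s = p x (s * τ)
  pol-arg (suc n) τ (c , g , m , p , f≡) = _ , _ , mem-* (τ ^ suc n) m , pol-arg n τ p ,
    λ x s → trans (f≡ x (s * τ)) (trans
      (cong (λ u → c x * u + g x (s * τ)) (^-distrib-* s τ (suc n)))
      (ring-arg (c x) (s ^ suc n) (τ ^ suc n) (g x (s * τ))))

  isPol-+ : ∀ {f g} → IsPol {M = M} f → IsPol {M = M} g → IsPol {M = M} (λ x t → f x t + g x t)
  isPol-+ (m , p) (n , q) = m ℕ.⊔ n , pol-+ (m ℕ.⊔ n) (pol-≤ (ℕ.m≤m⊔n m n) p) (pol-≤ (ℕ.m≤n⊔m m n) q)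

module _ {X : Set} (M : Submodule X) where
  open Submodule M

  -- The scale `s` joins the environment; what depends on it polynomially can be treated by the
  -- polynomial van der Waerden theorem in `s` afterwards.
  polynomials : Submodule (X × ℚ)
  polynomials = record
    { Mem = λ f → IsPol {M = M} (λ x s → f (x , s))
    ; mem-ext = λ eq (n , p) → n , pol-ext {M = M} n (λ x s → sym (eq (x , s))) p
    ; mem-0 = 0 , pol-0 {M = M} 0
    ; mem-+ = λ {f} {g} → isPol-+ {M = M} {f = λ x s → f (x , s)} {g = λ x s → g (x , s)}
    ; mem-* = λ k (n , p) → n , pol-* {M = M} n k p
    }

  -- With t = s τ, taking the negative power of s out of the degree i condition leaves this shift,
  -- where `e` is `n ∸ i`.
  rescale : ℕ → (X → ℚ → ℚ) → X × ℚ → ℚ → ℚ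
  rescale e p (x , s) τ = s ^ e * p x (s * τ)

  pol-rescale : ∀ n e {p} → Pol M n p → Pol polynomials n (rescale e p)
  pol-rescale zero e p (x , s) τ = trans (cong (s ^ e *_) (p x (s * τ))) (*-zeroʳ (s ^ e))
  pol-rescale (suc n) e (c , g , m , p , f≡) = _ , _ ,
    (suc n ℕ.+ e , pol-ext (suc n ℕ.+ e) (λ x s → trans (ring-coef (s ^ e) (c x) (s ^ suc n))
        (cong (c x *_) (sym (^-homo-* s (suc n) e)))) (pol-mono (n ℕ.+ e) m)) ,
    pol-rescale n e p ,
    λ (x , s) τ → trans
      (cong (s ^ e *_) (trans (f≡ x (s * τ)) (cong (λ u → c x * u + g x (s * τ)) (^-distrib-* s τ (suc n)))))
      (ring-pow (s ^ e) (c x) (s ^ suc n) (τ ^ suc n) (g x (s * τ)))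

  record Scaled : Set where
    constructor scaled
    field
      scale : ℚ
      scale>0 : Positive scale
      factor : ℚ
      factor>0 : Positive factor
      base : X → ℚ
      base-mem : Mem base

  open Scaled public

  value : Scaled → X → ℚ → ℚ
  value s x b₀ = factor s * (b₀ + base s x)

  Absorbs : ∀ {r} → ℕ → Family X → X → ℚ → (ℕ → ℚ → Fin r) → Scaled → Set
  Absorbs n P x b₀ C s = ∀ i → i ℕ.< n → ∀ p → p ∈ P →
    C i (scale s ^ i * value s x b₀ + p x (scale s)) ≡ C i (scale s ^ i * value s x b₀)

  -- `b₀` is chosen after the list: it takes up the outer position in the induction, and later it
  -- makes all values positive.
  ScaledVdW : ℕ → Family X → Set
  ScaledVdW n P = ∀ r → Σ (List Scaled) λ cs → ∀ x b₀ (C : ℕ → ℚ → Fin r) → Some cs (Absorbs n P x b₀ C)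

module ScaledStep {X : Set} (M : Submodule X) (n : ℕ) (P : Family X) (P-pol : ∀ p → p ∈ P → IsPol {M = M} p)
  (rec : ∀ P → (∀ p → p ∈ P → IsPol {M = polynomials M} p) → ScaledVdW (polynomials M) n P) (r : ℕ) where
  open Submodule M

  P′ : Family (X × ℚ)
  P′ = cartesianProductWith (λ i → rescale M (n ∸ i)) (upTo n) P

  P′-pol : ∀ p → p ∈ P′ → IsPol {M = polynomials M} p
  P′-pol p p∈ = go (∈-cartesianProductWith⁻ _ (upTo n) P p∈)
    where
    go : ∀ {p} → (∃ λ i → ∃ λ q → i ∈ upTo n × q ∈ P × p ≡ rescale M (n ∸ i) q) → IsPol {M = polynomials M} p
    go (i , q , _ , q∈ , refl) = let k , pol = P-pol q q∈ in k , pol-rescale M k (n ∸ i) pol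

  inner : List (Scaled (polynomials M))
  inner = proj₁ (rec P′ P′-pol r)

  -- The factor by which `outerColour` stretches its argument; division by it in `sumPol` leaves a
  -- shift by exactly `p` inside `C n`.
  denominator : Scaled (polynomials M) → ℚ
  denominator j = scale j ^ n * factor j

  denominator-inverse : ∀ j → Σ ℚ λ κ → Positive κ × denominator j * κ ≡ 1ℚ
  denominator-inverse j = inverse (denominator j)
    (pos*pos⇒pos (scale j ^ n) {{pow>0 (scale>0 j) n}} (factor j) {{factor>0 j}})

  basePol : Scaled (polynomials M) → X → ℚ → ℚ
  basePol j x s = base j (x , s)

  sumPol : Scaled (polynomials M) → (X → ℚ → ℚ) → X → ℚ → ℚ
  sumPol j p x s = base j (x , s) + proj₁ (denominator-inverse j) * p x (s * scale j)

  -- Shifts by `basePol j` and by `sumPol j p` both keep the colour of the outer position, so the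
  -- two shifted points agree in colour; this is the degree `n` condition.
  Q : Family X
  Q = map basePol inner ++ cartesianProductWith sumPol inner P

  Q-pol : ∀ q → q ∈ Q → IsPol {M = M} q
  Q-pol q q∈ = [ (λ q∈ → go₁ (∈-map⁻ basePol q∈)) , (λ q∈ → go₂ (∈-cartesianProductWith⁻ sumPol inner P q∈)) ]′
    (∈-++⁻ (map basePol inner) q∈)
    where
    go₁ : ∀ {q} → (∃ λ j → j ∈ inner × q ≡ basePol j) → IsPol {M = M} q
    go₁ (j , _ , refl) = base-mem j
    go₂ : ∀ {q} → (∃ λ j → ∃ λ p → j ∈ inner × p ∈ P × q ≡ sumPol j p) → IsPol {M = M} q
    go₂ (j , p , _ , p∈ , refl) = let k , pol = P-pol p p∈ in
      isPol-+ (base-mem j) (k , pol-* k (proj₁ (denominator-inverse j)) (pol-arg k (scale j) pol))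

  outer : List (Cand M)
  outer = proj₁ (PvdW-multi (polynomial-vdW Q Q-pol) r inner)

  -- The factor `σ ^ n`, with `σ` the inverse of `dif s`, undoes the substitution b = sⁿ a.
  combine : Cand M → Scaled (polynomials M) → Scaled M
  combine s j = let σ , σ>0 , _ = inverse (dif s) (dif>0 s) ; k , pol = base-mem j in
    scaled (dif s * scale j) (pos*pos⇒pos (dif s) {{dif>0 s}} (scale j) {{scale>0 j}})
      (σ ^ n * factor j) (pos*pos⇒pos (σ ^ n) {{pow>0 σ>0 n}} (factor j) {{factor>0 j}})
      (λ x → pos s x + base j (x , dif s)) (mem-+ (pos-mem s) (pol-eval k pol (dif s)))
    where
    pol-eval : ∀ n {p} → Pol M n p → ∀ t → Mem (λ x → p x t)
    pol-eval zero p t = mem-ext (λ x → sym (p x t)) mem-0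
    pol-eval (suc n) (c , g , m , p , f≡) t = mem-ext
      (λ x → trans (cong (_+ g x t) (*-comm (t ^ suc n) (c x))) (sym (f≡ x t)))
      (mem-+ (mem-* (t ^ suc n) m) (pol-eval n p t))

  combined : List (Scaled M)
  combined = cartesianProductWith combine outer inner

  module _ (x : X) (b₀ : ℚ) (C : ℕ → ℚ → Fin r) where

    outerColour : Scaled (polynomials M) → ℚ → Fin r
    outerColour j z = C n (scale j ^ n * (factor j * (b₀ + z)))

    innerColour : ℚ → ℕ → ℚ → Fin r
    innerColour σ i z = C i (σ ^ (n ∸ i) * z)

    module _ (s : Cand M) (inv : ∀ j → j ∈ inner → Solves M Q x (outerColour j) s) where
      e σ b* : ℚ
      e = dif s
      σ = proj₁ (inverse e (dif>0 s))
      b* = b₀ + pos s x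

      eσ : e * σ ≡ 1ℚ
      eσ = proj₂ (proj₂ (inverse e (dif>0 s)))

      module _ (j : Scaled (polynomials M)) (j∈ : j ∈ inner)
        (ih : Absorbs (polynomials M) n P′ (x , e) b* (innerColour σ) j) where
        τ b a : ℚ
        τ = scale j
        b = value (polynomials M) j (x , e) b*
        a = value M (combine s j) x b₀

        b-eq : factor j * (b₀ + (pos s x + base j (x , e))) ≡ b
        b-eq = cong (factor j *_) (sym (+-assoc b₀ (pos s x) (base j (x , e))))

        top : (e * τ) ^ n * a ≡ τ ^ n * b
        top = begin
          (e * τ) ^ n * a ≡⟨ cong (_* a) (^-distrib-* e τ n) ⟩
          (e ^ n * τ ^ n) * a ≡⟨ ring-n (e ^ n) (τ ^ n) (σ ^ n) (factor j) _ ⟩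
          (e ^ n * σ ^ n) * (τ ^ n * (factor j * (b₀ + (pos s x + base j (x , e)))))
            ≡⟨ 1*-elim _ (pow-inverse eσ n) ⟩
          τ ^ n * (factor j * (b₀ + (pos s x + base j (x , e)))) ≡⟨ cong (τ ^ n *_) b-eq ⟩
          τ ^ n * b ∎
          where open ≡-Reasoning

        low : ∀ {i} → i ℕ.≤ n → (e * τ) ^ i * a ≡ σ ^ (n ∸ i) * (τ ^ i * b)
        low {i} i≤n = begin
          (e * τ) ^ i * a ≡⟨ cong (_* a) (^-distrib-* e τ i) ⟩
          (e ^ i * τ ^ i) * a
            ≡⟨ cong (λ u → (e ^ i * τ ^ i) * ((u * factor j) * (b₀ + (pos s x + base j (x , e))))) (pow-split σ i≤n) ⟩
          (e ^ i * τ ^ i) * (((σ ^ (n ∸ i) * σ ^ i) * factor j) * (b₀ + (pos s x + base j (x , e))))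
            ≡⟨ ring-q (e ^ i) (τ ^ i) (σ ^ (n ∸ i)) (σ ^ i) (factor j) _ ⟩
          (e ^ i * σ ^ i) * (σ ^ (n ∸ i) * (τ ^ i * (factor j * (b₀ + (pos s x + base j (x , e))))))
            ≡⟨ 1*-elim _ (pow-inverse eσ i) ⟩
          σ ^ (n ∸ i) * (τ ^ i * (factor j * (b₀ + (pos s x + base j (x , e)))))
            ≡⟨ cong (λ u → σ ^ (n ∸ i) * (τ ^ i * u)) b-eq ⟩
          σ ^ (n ∸ i) * (τ ^ i * b) ∎
          where open ≡-Reasoning

        below : ∀ i → i ℕ.< n → ∀ p → p ∈ P → C i ((e * τ) ^ i * a + p x (e * τ)) ≡ C i ((e * τ) ^ i * a)
        below i i<n p p∈ = begin
          C i ((e * τ) ^ i * a + p x (e * τ)) ≡⟨ cong (C i) (cong₂ _+_ (low (ℕ.<⇒≤ i<n))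
            (sym (1*-elim (p x (e * τ)) (trans (*-comm (σ ^ (n ∸ i)) (e ^ (n ∸ i))) (pow-inverse eσ (n ∸ i)))))) ⟩
          C i (σ ^ (n ∸ i) * (τ ^ i * b) + (σ ^ (n ∸ i) * e ^ (n ∸ i)) * p x (e * τ))
            ≡⟨ cong (C i) (sym (ring-add (σ ^ (n ∸ i)) (τ ^ i * b) (e ^ (n ∸ i)) (p x (e * τ)))) ⟩
          C i (σ ^ (n ∸ i) * (τ ^ i * b + e ^ (n ∸ i) * p x (e * τ)))
            ≡⟨ ih i i<n (rescale M (n ∸ i) p) (∈-cartesianProductWith⁺ (λ i → rescale M (n ∸ i)) (∈-upTo⁺ i<n) p∈) ⟩
          C i (σ ^ (n ∸ i) * (τ ^ i * b)) ≡⟨ cong (C i) (sym (low (ℕ.<⇒≤ i<n))) ⟩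
          C i ((e * τ) ^ i * a) ∎
          where open ≡-Reasoning

        at-n : ∀ p → p ∈ P → C n ((e * τ) ^ n * a + p x (e * τ)) ≡ C n ((e * τ) ^ n * a)
        at-n p p∈ = begin
          C n ((e * τ) ^ n * a + v) ≡⟨ cong (λ u → C n (u + v)) top ⟩
          C n (τ ^ n * b + v) ≡⟨ cong (λ u → C n (τ ^ n * b + u))
            (sym (1*-elim v (proj₂ (proj₂ (denominator-inverse j))))) ⟩
          C n (τ ^ n * b + (denominator j * κ) * v) ≡⟨ cong (C n) (sym (ring-κ (τ ^ n) (factor j) (b* + base j (x , e)) κ v)) ⟩
          C n (τ ^ n * (factor j * (b* + base j (x , e) + κ * v)))
            ≡⟨ cong (λ u → C n (τ ^ n * (factor j * u))) (trans (+-assoc b* _ _) (+-assoc b₀ _ _)) ⟩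
          outerColour j (pos s x + sumPol j p x e)
            ≡⟨ inv j j∈ (sumPol j p) (∈-++⁺ʳ (map basePol inner) (∈-cartesianProductWith⁺ sumPol j∈ p∈)) ⟩
          outerColour j (pos s x) ≡⟨ sym (inv j j∈ (basePol j) (∈-++⁺ˡ (∈-map⁺ basePol j∈))) ⟩
          outerColour j (pos s x + basePol j x e) ≡⟨ cong (λ u → C n (τ ^ n * u)) b-eq ⟩
          C n (τ ^ n * b) ≡⟨ cong (C n) (sym top) ⟩
          C n ((e * τ) ^ n * a) ∎
          where
          open ≡-Reasoning
          κ v : ℚ
          κ = proj₁ (denominator-inverse j)
          v = p x (e * τ)

        absorbs : Absorbs M (suc n) P x b₀ C (combine s j)
        absorbs i i<1+n p p∈ = [ (λ i<n → below i i<n p p∈) , (λ { refl → at-n p p∈ }) ]′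
          (ℕ.m<1+n⇒m<n∨m≡n i<1+n)

    hit : Some combined (Absorbs M (suc n) P x b₀ C)
    hit =
      -- The outer solution comes first and serves all inner candidates at once; only then is the
      -- inner problem posed, with `dif s` in its environment.
      let s , s∈ , inv = proj₂ (PvdW-multi (polynomial-vdW Q Q-pol) r inner) x outerColour
          j , j∈ , ih = proj₂ (rec P′ P′-pol r) (x , dif s) (b₀ + pos s x) (innerColour (σ s inv))
      in combine s j , ∈-cartesianProductWith⁺ combine s∈ j∈ , absorbs s inv j j∈ ih

scaled-vdW : ∀ n {X : Set} (M : Submodule X) P → (∀ p → p ∈ P → IsPol {M = M} p) → ScaledVdW M n P
scaled-vdW zero M P _ r = scaled 1ℚ _ 1ℚ _ (λ _ → 0ℚ) (Submodule.mem-0 M) ∷ [] ,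
  λ x b₀ C → _ , here refl , λ _ ()
scaled-vdW (suc n) M P P-pol r = combined , hit
  where open ScaledStep M n P P-pol (scaled-vdW n (polynomials M)) r

scaledVdW-multi : ∀ {X : Set} {M : Submodule X} {n P} → ScaledVdW M n P → ∀ r {Y : Set} (W : List Y) →
  Σ (List (Scaled M)) λ cs → ∀ x b₀ (C : Y → ℕ → ℚ → Fin r) →
    Some cs λ s → ∀ y → y ∈ W → Absorbs M n P x b₀ (C y) s
scaledVdW-multi {X} {M} {n} {P} V r {Y} W = proj₁ (V (r ℕ.^ length W)) , hit
  where
  hit : ∀ x b₀ (C : Y → ℕ → ℚ → Fin r) →
    Some (proj₁ (V (r ℕ.^ length W))) λ s → ∀ y → y ∈ W → Absorbs M n P x b₀ (C y) s
  hit x b₀ C =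
    let s , s∈ , sol = proj₂ (V (r ℕ.^ length W)) x b₀ (λ i z → funToFin (λ k → C (List.lookup W k) i z))
    in s , s∈ , λ y y∈ i i<n p p∈ →
      subst (λ u → C u i (scale s ^ i * value M s x b₀ + p x (scale s)) ≡ C u i (scale s ^ i * value M s x b₀))
        (sym (lookup-index y∈))
        (trans (sym (finToFun-funToFin _ (index y∈)))
          (trans (cong (λ k → finToFun k (index y∈)) (sol i i<n p p∈)) (finToFun-funToFin _ (index y∈))))

-- Positive translates and finite enumerations.

positive-translate : ∀ (qs : List ℚ) → Σ ℚ λ b → ∀ q → q ∈ qs → Positive (b + q)
positive-translate [] = 0ℚ , λ _ ()
positive-translate (q ∷ qs) = let b , pos = positive-translate qs in
  -- Raising `b` keeps the earlier sums positive, and `1ℚ - q` makes the new sum at least one.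
  b ⊔ (1ℚ - q) , λ
    { _ (here refl) → positive (<-≤-trans (subst (0ℚ <_) (sym (ring-1 q)) (positive⁻¹ 1ℚ))
        (+-monoˡ-≤ q (p≤q⊔p b (1ℚ - q))))
    ; q′ (there q∈) → positive (<-≤-trans (positive⁻¹ (b + q′) {{pos q′ q∈}})
        (+-monoˡ-≤ q′ (p≤p⊔q b (1ℚ - q)))) }

vectors : ∀ {A : Set} → List A → ∀ n → List (Vec A n)
vectors xs zero = [] ∷ []
vectors xs (suc n) = cartesianProductWith _∷_ xs (vectors xs n)

∈-vectors : ∀ {A : Set} {xs : List A} → (∀ a → a ∈ xs) → ∀ {n} (v : Vec A n) → v ∈ vectors xs n
∈-vectors all [] = here refl
∈-vectors all (a ∷ v) = ∈-cartesianProductWith⁺ _∷_ (all a) (∈-vectors all v)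

subsets : ∀ n → List (Subset n)
subsets = vectors (true ∷ false ∷ [])

∈-subsets : ∀ {n} (S : Subset n) → S ∈ subsets n
∈-subsets = ∈-vectors λ { true → here refl ; false → there (here refl) }

-- Systems in which one summand of a sum of products determines its colour

infixr 6 _·_
_·_ : ∀ {n} → ℚ → (Fin n → ℚ) → Fin n → ℚ
(t · y) i = t * y i

-- The value 0 at the empty set lets vectors of m sets represent sums with fewer than m summands.
term : ∀ {n} → Subset n → (Fin n → ℚ) → ℚ
term [] y = 0ℚ
term (true ∷ S) y = y zero * prodSub S (y ∘ suc)
term (false ∷ S) y = term S (y ∘ suc)

sumTerms : ∀ {n m} → Vec (Subset n) m → (Fin n → ℚ) → ℚ
sumTerms [] y = 0ℚ
sumTerms (S ∷ v) y = term S y + sumTerms v y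

prodSub-cong : ∀ {n} (S : Subset n) {y z} → (∀ i → y i ≡ z i) → prodSub S y ≡ prodSub S z
prodSub-cong [] eq = refl
prodSub-cong (true ∷ S) eq = cong₂ _*_ (eq zero) (prodSub-cong S (eq ∘ suc))
prodSub-cong (false ∷ S) eq = prodSub-cong S (eq ∘ suc)

term-cong : ∀ {n} (S : Subset n) {y z} → (∀ i → y i ≡ z i) → term S y ≡ term S z
term-cong [] eq = refl
term-cong (true ∷ S) eq = cong₂ _*_ (eq zero) (prodSub-cong S (eq ∘ suc))
term-cong (false ∷ S) eq = term-cong S (eq ∘ suc)

sumTerms-cong : ∀ {n m} (v : Vec (Subset n) m) {y z} → (∀ i → y i ≡ z i) → sumTerms v y ≡ sumTerms v z
sumTerms-cong [] eq = refl
sumTerms-cong (S ∷ v) eq = cong₂ _+_ (term-cong S eq) (sumTerms-cong v eq)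

prodSub-scale : ∀ {n} (S : Subset n) t y → prodSub S (t · y) ≡ t ^ ∣ S ∣ * prodSub S y
prodSub-scale [] t y = refl
prodSub-scale (true ∷ S) t y = trans (cong (t * y zero *_) (prodSub-scale S t (y ∘ suc)))
  (ring-prod t (y zero) (t ^ ∣ S ∣) (prodSub S (y ∘ suc)))
prodSub-scale (false ∷ S) t y = prodSub-scale S t (y ∘ suc)

prodSub>0 : ∀ {n} (S : Subset n) {y} → (∀ i → Positive (y i)) → Positive (prodSub S y)
prodSub>0 [] y>0 = _
prodSub>0 (true ∷ S) {y} y>0 = pos*pos⇒pos (y zero) {{y>0 zero}} (prodSub S (y ∘ suc)) {{prodSub>0 S (y>0 ∘ suc)}}
prodSub>0 (false ∷ S) y>0 = prodSub>0 S (y>0 ∘ suc)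

everything : ∀ X → Submodule X
everything X = record { Mem = λ _ → ⊤ }

module _ {X : Set} where

  pol-*ᶠ : ∀ n (k : X → ℚ) {f} → Pol (everything X) n f → Pol (everything X) n (λ x t → k x * f x t)
  pol-*ᶠ zero k p x t = trans (cong (k x *_) (p x t)) (*-zeroʳ (k x))
  pol-*ᶠ (suc n) k (c , f , m , p , f≡) = (λ x → k x * c x) , _ , tt , pol-*ᶠ n k p ,
    λ x t → trans (cong (k x *_) (f≡ x t)) (ring-* (k x) (c x) (t ^ suc n) (f x t))

  isPol-term : ∀ {n} (S : Subset n) (y : X → Fin n → ℚ) → IsPol {M = everything X} (λ x t → term S (t · y x))
  isPol-term [] y = 0 , λ _ _ → refl
  isPol-term (true ∷ S) y = suc ∣ S ∣ , pol-ext {M = everything X} (suc ∣ S ∣)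
    (λ x t → trans (prodSub-scale (true ∷ S) t (y x)) (*-comm (t ^ suc ∣ S ∣) (prodSub (true ∷ S) (y x))))
    (pol-mono ∣ S ∣ {λ x → prodSub (true ∷ S) (y x)} tt)
  isPol-term (false ∷ S) y = isPol-term S (λ x → y x ∘ suc)

  isPol-sumTerms : ∀ {n m} (v : Vec (Subset n) m) (y : X → Fin n → ℚ) →
    IsPol {M = everything X} (λ x t → sumTerms v (t · y x))
  isPol-sumTerms [] y = 0 , λ _ _ → refl
  isPol-sumTerms (S ∷ v) y = isPol-+ {M = everything X} {f = λ x t → term S (t · y x)}
    {g = λ x t → sumTerms v (t · y x)} (isPol-term S y) (isPol-sumTerms v y)

module _ {r : ℕ} (C : ℚ → Fin r) (L : ℕ) where

  -- New elements are put in front, so the leading summand is the one containing the smallest index.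
  -- Overlaps between `U` and the sets of `v` are allowed.
  Leading : ∀ n → (Fin n → ℚ) → Set
  Leading zero y = ⊤
  Leading (suc n) y =
    (∀ U (v : Vec (Subset n) L) →
      C (y zero * prodSub U (y ∘ suc) + sumTerms v (y ∘ suc)) ≡ C (y zero * prodSub U (y ∘ suc)))
    × Leading n (y ∘ suc)

  leading-cong : ∀ n {y z} → (∀ i → y i ≡ z i) → Leading n y → Leading n z
  leading-cong zero eq _ = tt
  leading-cong (suc n) eq (top , rest) =
    (λ U v → subst₂ (λ a b → C (a + b) ≡ C a)
      (cong₂ _*_ (eq zero) (prodSub-cong U (eq ∘ suc))) (sumTerms-cong v (eq ∘ suc)) (top U v)) ,
    leading-cong n (eq ∘ suc) rest

  LeadingSystem : ℕ → List ℚ₊ → Set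
  LeadingSystem n T = Σ (Fin n → ℚ) λ y → (∀ i → Positive (y i)) × (∀ t → t ∈ T → Leading n (proj₁ t · y))

  module Extend (n : ℕ) (rec : ∀ T → LeadingSystem n T) (T : List ℚ₊) where
    X : Set
    X = Σ (Fin n → ℚ) λ y → ∀ i → Positive (y i)

    M : Submodule X
    M = everything X

    -- For the monomial with index set U, rescaled by t, the product with e · (a ∷ t · y) is coeff · (t ^ ∣ U ∣ · a).
    coeff : ℚ₊ × Subset n → X → ℚ
    coeff ((e , _) , U) (y , _) = e * (e ^ ∣ U ∣ * prodSub U y)

    coeff-inverse : ∀ c x → Σ ℚ λ κ → Positive κ × coeff c x * κ ≡ 1ℚ
    coeff-inverse ((e , e>0) , U) (y , y>0) = inverse (e * (e ^ ∣ U ∣ * prodSub U y))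
      (pos*pos⇒pos e {{e>0}} (e ^ ∣ U ∣ * prodSub U y)
        {{pos*pos⇒pos (e ^ ∣ U ∣) {{pow>0 e>0 ∣ U ∣}} (prodSub U y) {{prodSub>0 U y>0}}}})

    coeffs : List (ℚ₊ × Subset n)
    coeffs = cartesianProduct T (subsets n)

    -- Division by `coeff` cancels the factor that `colour` applies, so the sum over `v` appears
    -- unchanged inside `C`.
    shiftPol : ℚ₊ × Subset n → Vec (Subset n) L → X → ℚ → ℚ
    shiftPol c v x t = proj₁ (coeff-inverse c x) * sumTerms v (t * proj₁ (proj₁ c) · proj₁ x)

    P : Family X
    P = cartesianProductWith shiftPol coeffs (vectors (subsets n) L)

    P-pol : ∀ p → p ∈ P → IsPol {M = M} p
    P-pol p p∈ = go (∈-cartesianProductWith⁻ shiftPol coeffs (vectors (subsets n) L) p∈)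
      where
      go : ∀ {p} → (∃ λ c → ∃ λ v → c ∈ coeffs × v ∈ vectors (subsets n) L × p ≡ shiftPol c v) → IsPol {M = M} p
      go (c , v , _ , _ , refl) = let k , pol = isPol-sumTerms v proj₁ in
        k , pol-*ᶠ k (λ x → proj₁ (coeff-inverse c x)) (pol-arg {M = M} k (proj₁ (proj₁ c)) pol)

    candidates : List (Scaled M)
    -- The exponents are sizes of subsets of `n` elements, from 0 to `n`, hence `suc n` degrees.
    candidates = proj₁ (scaledVdW-multi (scaled-vdW (suc n) M P P-pol) r coeffs)

    times : ℚ₊ → Scaled M → ℚ₊
    times (e , e>0) s = e * scale s , pos*pos⇒pos e {{e>0}} (scale s) {{scale>0 s}}

    -- All scales by which `y` can end up multiplied; the shorter system must be leading under each
    -- of them.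
    T′ : List ℚ₊
    T′ = cartesianProductWith times T candidates

    module _ (x : X) (x-lead : ∀ t → t ∈ T′ → Leading n (proj₁ t · proj₁ x)) where
      y : Fin n → ℚ
      y = proj₁ x

      translate : Σ ℚ λ b → ∀ q → q ∈ List.map (λ s → base s x) candidates → Positive (b + q)
      translate = positive-translate (List.map (λ s → base s x) candidates)

      colour : ℚ₊ × Subset n → ℕ → ℚ → Fin r
      colour c _ z = C (coeff c x * z)

      module _ (s : Scaled M) (s∈ : s ∈ candidates)
        (absorbs : ∀ c → c ∈ coeffs → Absorbs M (suc n) P x (proj₁ translate) (colour c) s) where
        t a : ℚ
        t = scale s
        a = value M s x (proj₁ translate)

        new : Fin (suc n) → ℚ
        new = a VF.∷ (t · y)

        new>0 : ∀ i → Positive (new i)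
        new>0 zero = pos*pos⇒pos (factor s) {{factor>0 s}} (proj₁ translate + base s x)
          {{proj₂ translate _ (∈-map⁺ (λ s → base s x) s∈)}}
        new>0 (suc i) = pos*pos⇒pos t {{scale>0 s}} (y i) {{proj₂ x i}}

        top : ∀ e → e ∈ T → ∀ U (v : Vec (Subset n) L) →
          C (proj₁ e * a * prodSub U (proj₁ e · t · y) + sumTerms v (proj₁ e · t · y))
            ≡ C (proj₁ e * a * prodSub U (proj₁ e · t · y))
        top (e , e>0) e∈ U v = begin
          C (e * a * prodSub U (e · t · y) + sumTerms v (e · t · y))
            ≡⟨ cong C (cong₂ _+_ main rest) ⟩
          C (α * (t ^ ∣ U ∣ * a) + (α * κ) * sumTerms v (t * e · y))
            ≡⟨ cong C (sym (ring-add α (t ^ ∣ U ∣ * a) κ (sumTerms v (t * e · y)))) ⟩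
          C (α * (t ^ ∣ U ∣ * a + shiftPol c v x t))
            ≡⟨ absorbs c c∈ ∣ U ∣ (ℕ.s≤s (∣p∣≤n U)) (shiftPol c v)
                 (∈-cartesianProductWith⁺ shiftPol c∈ (∈-vectors ∈-subsets v)) ⟩
          C (α * (t ^ ∣ U ∣ * a)) ≡⟨ cong C (sym main) ⟩
          C (e * a * prodSub U (e · t · y)) ∎
          where
          open ≡-Reasoning
          c : ℚ₊ × Subset n
          c = (e , e>0) , U
          c∈ : c ∈ coeffs
          c∈ = ∈-cartesianProduct⁺ e∈ (∈-subsets U)
          α κ : ℚ
          α = coeff c x
          κ = proj₁ (coeff-inverse c x)
          main : e * a * prodSub U (e · t · y) ≡ α * (t ^ ∣ U ∣ * a)
          main = trans
            (cong (e * a *_) (trans (prodSub-scale U e (t · y)) (cong (e ^ ∣ U ∣ *_) (prodSub-scale U t y))))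
            (ring-lead e a (e ^ ∣ U ∣) (t ^ ∣ U ∣) (prodSub U y))
          rest : sumTerms v (e · t · y) ≡ (α * κ) * sumTerms v (t * e · y)
          rest = trans (sumTerms-cong v (λ i → ring-swap e t (y i)))
            (sym (1*-elim _ (proj₂ (proj₂ (coeff-inverse c x)))))

        new-leading : ∀ e → e ∈ T → Leading (suc n) (proj₁ e · new)
        new-leading e e∈ = top e e∈ ,
          leading-cong n (λ i → *-assoc (proj₁ e) t (y i))
            (x-lead (times e s) (∈-cartesianProductWith⁺ times e∈ s∈))

      extended : LeadingSystem (suc n) T
      extended =
        let s , s∈ , absorbs = proj₂ (scaledVdW-multi (scaled-vdW (suc n) M P P-pol) r coeffs) x (proj₁ translate) colour
        in new s s∈ absorbs , new>0 s s∈ absorbs , new-leading s s∈ absorbs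

  leading-system : ∀ n T → LeadingSystem n T
  leading-system zero T = (λ ()) , (λ ()) , λ _ _ → tt
  leading-system (suc n) T = let y , y>0 , lead = leading-system n T′ in extended (y , y>0) lead
    where open Extend n (leading-system n) T

-- Products over blocks.

blockTimes : ∀ {k} → ℚ → Maybe (Fin k) → (Fin k → ℚ) → Fin k → ℚ
blockTimes a nothing x = x
blockTimes a (just j) x i with i Fin.≟ j
... | yes _ = a * x i
... | no _ = x i

blockProd : ∀ {k M} → Blocks k M → (Fin M → ℚ) → Fin k → ℚ
blockProd [] y i = 1ℚ
blockProd (l ∷ φ) y = blockTimes (y zero) l (blockProd φ (y ∘ suc))

blockTimes>0 : ∀ {k} a → Positive a → ∀ l (x : Fin k → ℚ) → (∀ i → Positive (x i)) → ∀ i → Positive (blockTimes a l x i)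
blockTimes>0 a a>0 nothing x x>0 i = x>0 i
blockTimes>0 a a>0 (just j) x x>0 i with i Fin.≟ j
... | yes _ = pos*pos⇒pos a {{a>0}} (x i) {{x>0 i}}
... | no _ = x>0 i

blockProd>0 : ∀ {k M} (φ : Blocks k M) y → (∀ m → Positive (y m)) → ∀ i → Positive (blockProd φ y i)
blockProd>0 [] y y>0 i = _
blockProd>0 (l ∷ φ) y y>0 = blockTimes>0 (y zero) (y>0 zero) l _ (blockProd>0 φ (y ∘ suc) (y>0 ∘ suc))

blockTimes-suc : ∀ {k} a j (x : Fin (suc k) → ℚ) i → blockTimes a (just (suc j)) x (suc i) ≡ blockTimes a (just j) (x ∘ suc) i
blockTimes-suc a j x i with i Fin.≟ j
... | yes _ = refl
... | no _ = refl

prodSub-blockTimes : ∀ {k} a l (I : Subset k) x →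
  prodSub I (blockTimes a l x) ≡ (if select I l then a * prodSub I x else prodSub I x)
prodSub-blockTimes a nothing I x = refl
prodSub-blockTimes a (just zero) (true ∷ I) x = *-assoc a (x zero) (prodSub I (x ∘ suc))
prodSub-blockTimes a (just zero) (false ∷ I) x = refl
prodSub-blockTimes a (just (suc j)) (true ∷ I) x = trans
  (cong (x zero *_) (trans (prodSub-cong I (blockTimes-suc a j x)) (prodSub-blockTimes a (just j) I (x ∘ suc))))
  (if-* (Vec.lookup I j))
  where
  if-* : ∀ b → x zero * (if b then a * prodSub I (x ∘ suc) else prodSub I (x ∘ suc)) ≡
    (if b then a * (x zero * prodSub I (x ∘ suc)) else x zero * prodSub I (x ∘ suc))
  if-* true = ring-swap₃ (x zero) a _
  if-* false = refl
prodSub-blockTimes a (just (suc j)) (false ∷ I) x =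
  trans (prodSub-cong I (blockTimes-suc a j x)) (prodSub-blockTimes a (just j) I (x ∘ suc))

-- Blocks are disjoint, so the product of block products meets each position of the union exactly
-- once.
prodSub-blockProd : ∀ {k M} (φ : Blocks k M) I y → prodSub I (blockProd φ y) ≡ prodSub (union φ I) y
prodSub-blockProd [] I y = ones I
  where
  ones : ∀ {k} (I : Subset k) → prodSub I (λ _ → 1ℚ) ≡ 1ℚ
  ones [] = refl
  ones (true ∷ I) = trans (*-identityˡ _) (ones I)
  ones (false ∷ I) = ones I
prodSub-blockProd (l ∷ φ) I y = trans (prodSub-blockTimes (y zero) l I _) (go (select I l))
  where
  go : ∀ b → (if b then y zero * prodSub I (blockProd φ (y ∘ suc)) else prodSub I (blockProd φ (y ∘ suc))) ≡
    prodSub (b ∷ union φ I) y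
  go true = cong (y zero *_) (prodSub-blockProd φ I (y ∘ suc))
  go false = prodSub-blockProd φ I (y ∘ suc)

-- The leading summand of a sum over disjoint sets.

sumFin-cong : ∀ {ℓ} {f g : Fin ℓ → ℚ} → (∀ i → f i ≡ g i) → sumFin f ≡ sumFin g
sumFin-cong {zero} eq = refl
sumFin-cong {suc ℓ} eq = cong₂ _+_ (eq zero) (sumFin-cong (eq ∘ suc))

-- `g` is `f` with entry `j` replaced by zero, so a summand is taken out without changing the index
-- type.
sumFin-extract : ∀ {ℓ} (f g : Fin ℓ → ℚ) j → g j ≡ 0ℚ → (∀ i → i ≢ j → f i ≡ g i) → sumFin f ≡ f j + sumFin g
sumFin-extract f g zero g≡0 eq = cong (f zero +_)
  (trans (sumFin-cong (λ i → eq (suc i) λ ())) (trans (sym (+-identityˡ _)) (cong (_+ sumFin (g ∘ suc)) (sym g≡0))))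
sumFin-extract f g (suc j) g≡0 eq = trans
  (cong₂ _+_ (eq zero λ ()) (sumFin-extract (f ∘ suc) (g ∘ suc) j g≡0 (λ i i≢j → eq (suc i) (i≢j ∘ suc-injective))))
  (ring-swap₊ (g zero) (f (suc j)) (sumFin (g ∘ suc)))

term-⊥ : ∀ n (y : Fin n → ℚ) → term ⊥ y ≡ 0ℚ
term-⊥ zero y = refl
term-⊥ (suc n) y = term-⊥ n (y ∘ suc)

term-nonempty : ∀ {n} (S : Subset n) → Nonempty S → ∀ y → prodSub S y ≡ term S y
term-nonempty (true ∷ S) _ y = refl
term-nonempty (false ∷ S) (suc i , Vec.there i∈) y = term-nonempty S (i , i∈) (y ∘ suc)

pad : ∀ {n ℓ L} → ℓ ℕ.≤ L → (S : Fin ℓ → Subset n) → ∀ y →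
  Σ (Vec (Subset n) L) λ v → sumTerms v y ≡ sumFin (λ i → term (S i) y)
pad {n} {zero} {L} _ S y = Vec.replicate L ⊥ , zeros L
  where
  zeros : ∀ L → sumTerms (Vec.replicate L ⊥) y ≡ 0ℚ
  zeros zero = refl
  zeros (suc L) = trans (cong₂ _+_ (term-⊥ n y) (zeros L)) (+-identityˡ 0ℚ)
pad {ℓ = suc ℓ} (ℕ.s≤s ℓ≤L) S y = let v , eq = pad ℓ≤L (S ∘ suc) y in
  S zero ∷ v , cong (term (S zero) y +_) eq

tail-nonempty : ∀ {n} (S : Subset (suc n)) → Vec.lookup S zero ≢ true → Nonempty S → Nonempty (tail S)
tail-nonempty (_ ∷ S) S∌0 (zero , Vec.here) = contradiction refl S∌0
tail-nonempty (_ ∷ S) S∌0 (suc i , Vec.there i∈) = i , i∈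

prodSub-tail : ∀ {n} (S : Subset (suc n)) → Vec.lookup S zero ≢ true → ∀ y → prodSub S y ≡ prodSub (tail S) (y ∘ suc)
prodSub-tail (true ∷ S) S∌0 y = contradiction refl S∌0
prodSub-tail (false ∷ S) S∌0 y = refl

prodSub-head : ∀ {n} (S : Subset (suc n)) → Vec.lookup S zero ≡ true → ∀ y → prodSub S y ≡ y zero * prodSub (tail S) (y ∘ suc)
prodSub-head (true ∷ S) _ y = refl

tail∈ : ∀ {n i} {S : Subset (suc n)} → i ∈ₛ tail S → suc i ∈ₛ S
tail∈ {S = _ ∷ S} i∈ = Vec.there i∈

module _ {r : ℕ} (C : ℚ → Fin r) (L : ℕ) where

  -- By disjointness at most one set contains index `zero`. If one does, it leads by `top`;
  -- otherwise the index is dropped.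
  leading-summand : ∀ n y → Leading C L n y → ∀ {ℓ} → ℓ ≥ 1 → ℓ ℕ.≤ L → (S : Fin ℓ → Subset n) →
    (∀ j → Nonempty (S j)) → PairwiseDisjoint S →
    ∃ λ j → C (sumFin (λ i → prodSub (S i) y)) ≡ C (prodSub (S j) y)
  leading-summand zero y _ {suc ℓ} _ _ S ne _ = contradiction (proj₁ (ne zero)) λ ()
  leading-summand (suc n) y (top , lead) {ℓ} ℓ≥1 ℓ≤L S ne disj = go (any? λ j → Vec.lookup (S j) zero Bool.≟ true)
    where
    go : Dec (∃ λ j → Vec.lookup (S j) zero ≡ true) →
      ∃ λ j → C (sumFin (λ i → prodSub (S i) y)) ≡ C (prodSub (S j) y)
    go (no ¬0) =
      let j , eq = leading-summand n (y ∘ suc) lead ℓ≥1 ℓ≤L (tail ∘ S)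
            (λ j → tail-nonempty (S j) (λ e → ¬0 (j , e)) (ne j))
            (λ a b a≢b i i∈a i∈b → disj a b a≢b (suc i) (tail∈ i∈a) (tail∈ i∈b))
          drop = λ j → prodSub-tail (S j) (λ e → ¬0 (j , e)) y
      in j , trans (cong C (sumFin-cong drop)) (trans eq (cong C (sym (drop j))))
    go (yes (j , Sⱼ∋0)) = j , (begin
      C (sumFin f) ≡⟨ cong C (sumFin-extract f g j g≡0 f≡g) ⟩
      C (f j + sumFin g) ≡⟨ cong C (cong₂ _+_ (prodSub-head (S j) Sⱼ∋0 y) (sym (proj₂ padded))) ⟩
      C (y zero * prodSub (tail (S j)) (y ∘ suc) + sumTerms (proj₁ padded) (y ∘ suc)) ≡⟨ top (tail (S j)) (proj₁ padded) ⟩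
      C (y zero * prodSub (tail (S j)) (y ∘ suc)) ≡⟨ cong C (sym (prodSub-head (S j) Sⱼ∋0 y)) ⟩
      C (f j) ∎)
      where
      open ≡-Reasoning
      rest : Fin ℓ → Subset n
      rest i with i Fin.≟ j
      ... | yes _ = ⊥
      ... | no _ = tail (S i)
      f g : Fin ℓ → ℚ
      f i = prodSub (S i) y
      g i = term (rest i) (y ∘ suc)
      padded : Σ (Vec (Subset n) L) λ v → sumTerms v (y ∘ suc) ≡ sumFin g
      padded = pad ℓ≤L rest (y ∘ suc)
      g≡0 : g j ≡ 0ℚ
      g≡0 with j Fin.≟ j
      ... | yes _ = term-⊥ n (y ∘ suc)
      ... | no j≢j = contradiction refl j≢j
      f≡g : ∀ i → i ≢ j → f i ≡ g i
      f≡g i i≢j with i Fin.≟ j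
      ... | yes i≡j = contradiction i≡j i≢j
      ... | no _ = trans (prodSub-tail (S i) Sᵢ∌0 y) (term-nonempty (tail (S i)) (tail-nonempty (S i) Sᵢ∌0 (ne i)) (y ∘ suc))
        where
        Sᵢ∌0 : Vec.lookup (S i) zero ≢ true
        Sᵢ∌0 e = disj i j i≢j zero (lookup⇒[]= zero (S i) e) (lookup⇒[]= zero (S j) Sⱼ∋0)

union∈ : ∀ {k M} (φ : Blocks k M) I m → m ∈ₛ union φ I → ∃ λ i → Vec.lookup φ m ≡ just i × i ∈ₛ I
union∈ φ I m m∈ = go (Vec.lookup φ m) refl (trans (sym (lookup-map m (select I) φ)) ([]=⇒lookup m∈))
  where
  go : ∀ l → Vec.lookup φ m ≡ l → select I l ≡ true → ∃ λ i → Vec.lookup φ m ≡ just i × i ∈ₛ I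
  go (just i) eq sel = i , eq , lookup⇒[]= i I sel

union-disjoint : ∀ {ℓ k M} (φ : Blocks k M) (I : Fin ℓ → Subset k) → PairwiseDisjoint I → PairwiseDisjoint (union φ ∘ I)
union-disjoint φ I disj a b a≢b m m∈a m∈b =
  let i , eq , i∈ = union∈ φ (I a) m m∈a
      j , eq′ , j∈ = union∈ φ (I b) m m∈b
  in disj a b a≢b i i∈ (subst (_∈ₛ I b) (just-inj (trans (sym eq′) eq)) j∈)
  where
  just-inj : ∀ {A : Set} {x y : A} → just x ≡ just y → x ≡ y
  just-inj refl = refl

-- Choosing one element from each set is injective. This bounds the number of summands, so `k` can
-- serve as `L`.
disjoint-length : ∀ {ℓ k} (I : Fin ℓ → Subset k) → (∀ j → Nonempty (I j)) → PairwiseDisjoint I → ℓ ℕ.≤ k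
disjoint-length I ne disj = injective⇒≤ {f = λ j → proj₁ (ne j)} λ {a} {b} eq → inj a b eq (a Fin.≟ b)
  where
  inj : ∀ a b → proj₁ (ne a) ≡ proj₁ (ne b) → Dec (a ≡ b) → a ≡ b
  inj a b eq (yes a≡b) = a≡b
  inj a b eq (no a≢b) = contradiction (subst (_∈ₛ I b) (sym eq) (proj₂ (ne b))) (disj a b a≢b _ (proj₂ (ne a)))

-- Passage to colourings of all rationals, and the theorem.

positive-irrelevant : ∀ {q} (a b : Positive q) → a ≡ b
positive-irrelevant {mkℚ +[1+ _ ] _ _} a b = refl

-- The recurrence theorems colour all rationals; nonpositive ones get the colour of 1 as a default.
extendColouring : ∀ {r} → (ℚ₊ → Fin r) → ℚ → Fin r
extendColouring C q with 0ℚ <? q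
... | yes q>0 = C (q , positive q>0)
... | no _ = C (1ℚ , _)

extendColouring-eq : ∀ {r} (C : ℚ₊ → Fin r) q → extendColouring C (proj₁ q) ≡ C q
extendColouring-eq C (q , q>0) with 0ℚ <? q
... | yes _ = cong (λ pf → C (q , pf)) (positive-irrelevant {q} _ q>0)
... | no q≯0 = contradiction (positive⁻¹ q {{q>0}}) q≯0

theorem1p3 : (r k : ℕ) → r ≥ 1 → k ≥ 1 → (C : ℚ₊ → Fin r) →
    Σ (Fin k → ℚ₊) λ x → Σ (Fin r) λ c →
    (ℓ : ℕ) → ℓ ≥ 1 → (I : Fin ℓ → Subset k) →
    ((j : Fin ℓ) → Nonempty (I j)) → PairwiseDisjoint I →
    (q : ℚ₊) → proj₁ q ≡ sumFin (λ j → prodSub (I j) (λ i → proj₁ (x i))) →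
    C q ≡ c
theorem1p3 r k _ _ C = x , col , monochromatic
  where
  Ĉ : ℚ → Fin r
  Ĉ = extendColouring C

  size : ∃ λ M → ∀ (c : Subset M → Fin r) → Σ (Fin r) λ col → Mono c col k
  -- The colour of 1 shows that there is a colour at all.
  size = folkman (C (1ℚ , _)) k

  system : LeadingSystem Ĉ k (proj₁ size) ((1ℚ , _) ∷ [])
  system = leading-system Ĉ k (proj₁ size) ((1ℚ , _) ∷ [])

  y : Fin (proj₁ size) → ℚ
  y = proj₁ system

  y-leading : Leading Ĉ k (proj₁ size) y
  y-leading = leading-cong Ĉ k (proj₁ size) (λ i → *-identityˡ (y i)) (proj₂ (proj₂ system) _ (here refl))

  blocks : Σ (Fin r) λ col → Mono (λ S → Ĉ (prodSub S y)) col k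
  blocks = proj₂ size (λ S → Ĉ (prodSub S y))

  col : Fin r
  col = proj₁ blocks

  φ : Blocks k (proj₁ size)
  φ = proj₁ (proj₂ blocks)

  x : Fin k → ℚ₊
  x i = blockProd φ y i , blockProd>0 φ y (proj₁ (proj₂ system)) i

  monochromatic : ∀ ℓ → ℓ ≥ 1 → (I : Fin ℓ → Subset k) → (∀ j → Nonempty (I j)) → PairwiseDisjoint I →
    ∀ q → proj₁ q ≡ sumFin (λ j → prodSub (I j) (λ i → proj₁ (x i))) → C q ≡ col
  monochromatic ℓ ℓ≥1 I ne disj q q≡ = begin
    C q ≡⟨ sym (extendColouring-eq C q) ⟩
    Ĉ (proj₁ q) ≡⟨ cong Ĉ (trans q≡ (sumFin-cong (λ j → prodSub-blockProd φ (I j) y))) ⟩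
    Ĉ (sumFin (λ j → prodSub (union φ (I j)) y)) ≡⟨ proj₂ leader ⟩
    -- The leading summand is the product over a union of blocks, whose colour Folkman's theorem has
    -- fixed.
    Ĉ (prodSub (union φ (I (proj₁ leader))) y) ≡⟨ proj₂ (proj₂ (proj₂ blocks)) (I (proj₁ leader)) (ne (proj₁ leader)) ⟩
    col ∎
    where
    open ≡-Reasoning
    leader : ∃ λ j → Ĉ (sumFin (λ i → prodSub (union φ (I i)) y)) ≡ Ĉ (prodSub (union φ (I j)) y)
    leader = leading-summand Ĉ k (proj₁ size) y y-leading ℓ≥1 (disjoint-length I ne disj) (λ i → union φ (I i))
      (λ j → union-nonempty {φ = φ} (proj₁ (proj₂ (proj₂ blocks))) (ne j)) (union-disjoint φ I disj)
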